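{- Let $n\geq 2$ and let $X$ be a symmetric $n\times n$ matrix with $x_{i,i}=0$ for all $i$ and $x_{i,j}=x_{j,i}\in\{\pm 1\}$ for all $i\neq j$. The spindle algorithm described in the context, applied to $X$, is correct: (a) If the algorithm is successful, i.e. it stops by outputting $\sigma$ and $\gamma$, then $\sigma$ and $\gamma$ are permutations of $\{1,\dots,n\}$, the linking matrix of the spindle-permutation $\sigma$ is in the switching class of $X$, and $\gamma$ yields a conjugation between the two matrices. More precisely, after the normalization of $X$ in the initialization step (so that $x_{1,i}=x_{i,1}=1$ for $2\leq i\leq n$), $$x_{\gamma(i),\gamma(j)}=\mathrm{sign}\big((i-j)(\sigma(i)-\sigma(j))\big)\qquad\text{for all } 1\leq i,j\leq n .$$ (b) If the algorithm fails, i.e. it stops with the output ``no spindle structure exists for this switching class'', then there is no permutation of $\{1,\dots,n\}$ whose linking matrix is in the switching class of $X$. Moreover, the algorithm always stops with one of these two outputs. Thus it constructs a spindle-permutation with linking matrix in the switching class of $X$, or proves non-existence of such a permutation.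
   Context: Notation: $\mathrm{sign}(0)=0$ and $\mathrm{sign}(x)=x/|x|$ for $x\neq0$. Two symmetric $n\times n$ matrices $X,Y$ with zero diagonal and off-diagonal coefficients in $\{\pm1\}$ are switching-equivalent if $Y=D\,P^t\,X\,P\,D$ for a permutation matrix $P$ and a diagonal matrix $D$ with diagonal entries in $\{\pm1\}$; the equivalence classes are called switching classes. A spindle-permutation is a permutation $\sigma$ of $\{1,\dots,n\}$; its linking matrix is the matrix with $(i,j)$ entry $\mathrm{sign}((i-j)(\sigma(i)-\sigma(j)))$. The spindle algorithm on input $X$: Initialization. Conjugate $X$ by the diagonal matrix with diagonal coefficients $(1,x_{1,2},x_{1,3},\dots,x_{1,n})$; the resulting matrix is again denoted $X=(x_{i,j})$. Set $\gamma(1)=\gamma(2)=1$, $\sigma(1)=1$ and $k=2$. Main loop. Replace $\gamma(k)$ by $\gamma(k)+1$ and set $$\sigma(k)=1+\sharp\{j\mid x_{\gamma(k),j}=-1\}+\sum_{s=1}^{k-1}x_{\gamma(s),\gamma(k)}.$$ Check the following conditions: (1) $\gamma(k)\neq\gamma(s)$ for all $s\in\{1,\dots,k-1\}$; (2) $x_{\gamma(k),\gamma(s)}=\mathrm{sign}(\sigma(k)-\sigma(s))$ for all $s\in\{1,\dots,k-1\}$; (3) for all $j\in\{1,\dots,n\}\setminus\{\gamma(1),\dots,\gamma(k)\}$ and all $s\in\{1,\dots,k-1\}$: if $x_{j,\gamma(s)}\,x_{\gamma(s),\gamma(k)}=-1$, then $x_{j,\gamma(k)}=x_{j,\gamma(s)}$.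 If all three conditions are fulfilled: if $k=n$, output $i\mapsto\sigma(i)$ and $i\mapsto\gamma(i)$ and stop; if $k<n$, set $\gamma(k+1)=1$, replace $k$ by $k+1$ and iterate the main loop. If at least one condition is not fulfilled: while $\gamma(k)=n$, replace $k$ by $k-1$. Then, if $k=1$, output ``no spindle structure exists for this switching class'' and stop; if $k>1$, iterate the main loop. -}

module Defs where

open import Data.Nat as ℕ using (ℕ; suc; s≤s; z≤n)
open import Data.Nat.Properties using (≤-trans; suc-injective)
open import Data.Integer using (ℤ; +_; +0; +[1+_]; -[1+_]; 0ℤ; 1ℤ; -1ℤ; _+_; _-_; _*_)
open import Data.Integer.Properties using (+-0-commutativeMonoid) renaming (_≟_ to _≟ℤ_)
open import Data.Fin using (Fin; toℕ; fromℕ<; _<_; _≤_; _<?_; _≟_)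
open import Data.Fin.Properties using (toℕ-injective)
open import Data.Fin.Permutation using (Permutation′; _⟨$⟩ʳ_)
open import Data.List using (length; filter; allFin)
open import Data.Vec.Functional using (Vector; updateAt; transpose)
open import Data.Bool using (if_then_else_)
open import Data.Product using (_×_; ∃-syntax)
open import Data.Sum using (_⊎_)
open import Function using (const)
open import Relation.Nullary using (¬_; does; contradiction)
open import Relation.Binary.PropositionalEquality using (_≡_; _≢_; refl; sym; trans; cong)
open import Relation.Binary.Construct.Closure.ReflexiveTransitive using (Star)
open import Algebra.Properties.CommutativeMonoid.Sum +-0-commutativeMonoid using (sum-syntax)

-- Indices 1, …, n are represented by Fin n, so the index i of the text is the
-- element i - 1 of Fin n.

Matrix : ℕ → Set
Matrix n = Vector (Vector ℤ n) n

infix 4 _≐_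
_≐_ : ∀ {n} → Matrix n → Matrix n → Set
A ≐ B = ∀ i j → A i j ≡ B i j

infixl 7 _⊗_
_⊗_ : ∀ {n} → Matrix n → Matrix n → Matrix n
_⊗_ {n} A B i j = ∑[ k < n ] (A i k * B k j)

diag : ∀ {n} → Vector ℤ n → Matrix n
diag d i j = if does (i ≟ j) then d i else 0ℤ

-- Column j is the basis vector e_π(j); hence (Pᵗ X P) i j = X (π i) (π j).
permMatrix : ∀ {n} → Permutation′ n → Matrix n
permMatrix π i j = if does (i ≟ π ⟨$⟩ʳ j) then 1ℤ else 0ℤ

IsSign : ℤ → Set
IsSign x = x ≡ 1ℤ ⊎ x ≡ -1ℤ

record IsSignMatrix {n} (X : Matrix n) : Set where
  field
    symmetric    : ∀ i j → X i j ≡ X j i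
    zeroDiagonal : ∀ i → X i i ≡ 0ℤ
    offDiagonal  : ∀ i j → i ≢ j → IsSign (X i j)

ConjugateVia : ∀ {n} → Permutation′ n → Matrix n → Matrix n → Set
ConjugateVia π X Y =
  ∃[ d ] (∀ i → IsSign (d i)) ×
    Y ≐ diag d ⊗ transpose (permMatrix π) ⊗ X ⊗ permMatrix π ⊗ diag d

SwitchingEquivalent : ∀ {n} → Matrix n → Matrix n → Set
SwitchingEquivalent X Y = ∃[ π ] ConjugateVia π X Y

sign : ℤ → ℤ
sign +0       = 0ℤ
sign +[1+ _ ] = 1ℤ
sign -[1+ _ ] = -1ℤ

infixl 6 _⊖ᶠ_
_⊖ᶠ_ : ∀ {n} → Fin n → Fin n → ℤ
i ⊖ᶠ j = + toℕ i - + toℕ j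

linking : ∀ {n} → Permutation′ n → Matrix n
linking σ i j = sign ((i ⊖ᶠ j) * ((σ ⟨$⟩ʳ i) ⊖ᶠ (σ ⟨$⟩ʳ j)))

-- i is the index called n in the text.
IsLast : ∀ {n} → Fin n → Set
IsLast {n} i = suc (toℕ i) ≡ n

-- j = i + 1; there is no such j when i is the last index.
_⋖_ : ∀ {n} → Fin n → Fin n → Set
i ⋖ j = toℕ j ≡ suc (toℕ i)

infixl 8 _[_≔_]
_[_≔_] : ∀ {A : Set} {n} → Vector A n → Fin n → A → Vector A n
v [ i ≔ a ] = updateAt v i (const a)

-- The value computed for σ(k) is a priori only an integer.  It is 1-based, i.e.
-- the claim of correctness is that the output σ takes its values in {1, …, n}.
record State (n : ℕ) : Set where
  constructor ⟨_,_,_⟩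
  field
    k : Fin n
    γ : Vector (Fin n) n
    σ : Vector ℤ n

data Output (n : ℕ) : Set where
  spindle   : (σ : Vector ℤ n) (γ : Vector (Fin n) n) → Output n
  noSpindle : Output n

-- The points of the program: the beginning of the main loop, the test of the
-- three conditions, the test of the "while" loop, and the end.
data Config (n : ℕ) : Set where
  main      : State n → Config n
  check     : State n → Config n
  backtrack : State n → Config n
  halt      : Output n → Config n

module SpindleAlgorithm {n : ℕ} (2≤n : 2 ℕ.≤ n) (X₀ : Matrix n) where

  first second : Fin n
  first  = fromℕ< (≤-trans (s≤s z≤n) 2≤n)
  second = fromℕ< 2≤n

  normalizer : Vector ℤ n
  normalizer i = if does (i ≟ first) then 1ℤ else X₀ first i

  normalized : Matrix n
  normalized = diag normalizer ⊗ X₀ ⊗ diag normalizer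

  private
    X = normalized

  -- Only the entries γ(1), γ(2) and σ(1) are prescribed; the other initial
  -- values are arbitrary, since they are overwritten before being read.
  initial : Config n
  initial = main ⟨ second , const first , const 1ℤ ⟩

  σ-value : Fin n → Vector (Fin n) n → ℤ
  σ-value k γ =
    1ℤ + + length (filter (λ j → X (γ k) j ≟ℤ -1ℤ) (allFin n))
       + ∑[ s < n ] (if does (s <? k) then X (γ s) (γ k) else 0ℤ)

  record Conditions (st : State n) : Set where
    open State st
    field
      condition₁ : ∀ s → s < k → γ k ≢ γ s
      condition₂ : ∀ s → s < k → X (γ k) (γ s) ≡ sign (σ k - σ s)
      condition₃ : ∀ j → (∀ t → t ≤ k → j ≢ γ t) → ∀ s → s < k →
                   X j (γ s) * X (γ s) (γ k) ≡ -1ℤ → X j (γ k) ≡ X j (γ s)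

  infix 4 _⟶_ _⟶*_
  data _⟶_ : Config n → Config n → Set where

    advance : ∀ {k γ σ c} → γ k ⋖ c → let γ′ = γ [ k ≔ c ] in
              main ⟨ k , γ , σ ⟩ ⟶ check ⟨ k , γ′ , σ [ k ≔ σ-value k γ′ ] ⟩

    succeed : ∀ {k γ σ} → Conditions ⟨ k , γ , σ ⟩ → IsLast k →
              check ⟨ k , γ , σ ⟩ ⟶ halt (spindle σ γ)

    extend  : ∀ {k γ σ k⁺} → Conditions ⟨ k , γ , σ ⟩ → k ⋖ k⁺ →
              check ⟨ k , γ , σ ⟩ ⟶ main ⟨ k⁺ , γ [ k⁺ ≔ first ] , σ ⟩

    reject  : ∀ {st} → ¬ Conditions st → check st ⟶ backtrack st

    retreat : ∀ {k γ σ k⁻} → IsLast (γ k) → k⁻ ⋖ k →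
              backtrack ⟨ k , γ , σ ⟩ ⟶ backtrack ⟨ k⁻ , γ , σ ⟩

    fail    : ∀ {k γ σ} → ¬ IsLast (γ k) → k ≡ first →
              backtrack ⟨ k , γ , σ ⟩ ⟶ halt noSpindle

    resume  : ∀ {k γ σ} → ¬ IsLast (γ k) → k ≢ first →
              backtrack ⟨ k , γ , σ ⟩ ⟶ main ⟨ k , γ , σ ⟩

  _⟶*_ : Config n → Config n → Set
  _⟶*_ = Star _⟶_

  StopsWith : Output n → Set
  StopsWith o = initial ⟶* halt o

  private
    not-last : ∀ {i j : Fin n} → i ⋖ j → ¬ IsLast i
    not-last {i} {j} i⋖j last = <-irrefl (trans i⋖j last) (toℕ<n j)
      where
      open import Data.Nat.Properties using (<-irrefl)
      open import Data.Fin.Properties using (toℕ<n)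

    ⋖-functional : ∀ {i j j′ : Fin n} → i ⋖ j → i ⋖ j′ → j ≡ j′
    ⋖-functional p q = toℕ-injective (trans p (sym q))

    ⋖-injective : ∀ {i i′ j : Fin n} → i ⋖ j → i′ ⋖ j → i ≡ i′
    ⋖-injective p q = toℕ-injective (suc-injective (trans (sym p) q))

  -- Hence there is at most one run, and an output is reached as soon as some
  -- derivation of StopsWith exists.
  ⟶-deterministic : ∀ {c c₁ c₂} → c ⟶ c₁ → c ⟶ c₂ → c₁ ≡ c₂
  ⟶-deterministic (advance {k} {γ} {σ} p) (advance q) =
    cong (λ c → check ⟨ k , γ [ k ≔ c ] , σ [ k ≔ σ-value k (γ [ k ≔ c ]) ] ⟩)
         (⋖-functional p q)
  ⟶-deterministic (succeed _ _) (succeed _ _) = refl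
  ⟶-deterministic (succeed _ l) (extend _ p)  = contradiction l (not-last p)
  ⟶-deterministic (succeed c _) (reject ¬c)   = contradiction c ¬c
  ⟶-deterministic (extend _ p)  (succeed _ l) = contradiction l (not-last p)
  ⟶-deterministic (extend {γ = γ} {σ} _ p) (extend _ q) =
    cong (λ k → main ⟨ k , γ [ k ≔ first ] , σ ⟩) (⋖-functional p q)
  ⟶-deterministic (extend c _)  (reject ¬c)   = contradiction c ¬c
  ⟶-deterministic (reject ¬c)   (succeed c _) = contradiction c ¬c
  ⟶-deterministic (reject ¬c)   (extend c _)  = contradiction c ¬c
  ⟶-deterministic (reject _)    (reject _)    = refl
  ⟶-deterministic (retreat {γ = γ} {σ} _ p) (retreat _ q) =
    cong (λ k → backtrack ⟨ k , γ , σ ⟩) (⋖-injective p q)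
  ⟶-deterministic (retreat l _) (fail ¬l _)   = contradiction l ¬l
  ⟶-deterministic (retreat l _) (resume ¬l _) = contradiction l ¬l
  ⟶-deterministic (fail ¬l _)   (retreat l _) = contradiction l ¬l
  ⟶-deterministic (fail _ _)    (fail _ _)    = refl
  ⟶-deterministic (fail _ p)    (resume _ ¬p) = contradiction p ¬p
  ⟶-deterministic (resume ¬l _) (retreat l _) = contradiction l ¬l
  ⟶-deterministic (resume _ ¬p) (fail _ p)    = contradiction p ¬p
  ⟶-deterministic (resume _ _)  (resume _ _)  = refl

{-# OPTIONS --safe #-}
module Submission where

-- The main loop is a depth-first search, in lexicographic order, through the injective sequences
-- (γ(1) = 1, γ(2), …); conditions (1)-(3) hold for every prefix of a solution, so pruning by them
-- loses nothing.  A full sequence satisfying (1) and (2) makes γ a permutation with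
-- x_γ(i),γ(j) = sign((i-j)(σ(i)-σ(j))), and then the formula for σ(k) counts 1 + #{j | σ(j) < σ(k)}:
-- hence σ, being injective with values in {1, …, n}, is a permutation.  Conversely, cyclic rotations
-- of the indices and of the values of a permutation change its linking matrix only by a diagonal
-- conjugation.  So if X is equivalent to a linking matrix, it is equivalent to one with γ(1) = 1 and
-- σ(1) = 1; its first row is then normalized, which forces equality with the normalization of X.

open import Defs
import Algebra.Properties.CommutativeMonoid.Sum
open import Data.Bool using (true; false; if_then_else_)
open import Data.Nat as ℕ using (ℕ; zero; suc; _≤_; z≤n; s≤s)
import Data.Nat.Properties as ℕ
open import Data.Integer as ℤ using (ℤ; +_; +0; +[1+_]; -[1+_]; 0ℤ; 1ℤ; -1ℤ; _+_; _*_; _-_; -<+; +<+)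
import Data.Integer.Properties as ℤ
open import Data.Integer.Tactic.RingSolver using (solve-∀)
open import Data.Fin as Fin using (Fin; zero; suc; toℕ; fromℕ<; punchOut)
import Data.Fin.Properties as Fin
open import Data.Fin.Permutation
  using (Permutation′; permutation; flip; _∘ₚ_; _⟨$⟩ʳ_; _⟨$⟩ˡ_; inverseˡ; inverseʳ)
open import Data.List using (length; filter; tabulate; allFin)
open import Data.Vec.Functional using (Vector; transpose; removeAt)
open import Data.Vec.Functional.Properties using (updateAt-updates; updateAt-minimal)
open import Data.Product using (_×_; _,_; ∃-syntax; proj₁; proj₂)
open import Data.Sum using (_⊎_; inj₁; inj₂)
open import Function using (_∘_; const; id)
open import Function.Definitions using (Injective)
open import Relation.Nullary using (¬_; Dec; yes; no; does; contradiction)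
open import Relation.Nullary.Decidable using (dec-true; dec-false; map′; ¬?; _→-dec_; _×-dec_)
open import Relation.Binary using (tri<; tri≈; tri>)
open import Relation.Binary.PropositionalEquality
open import Relation.Binary.Construct.Closure.ReflexiveTransitive using (ε; _◅_; _◅◅_)

private
  module Sum = Algebra.Properties.CommutativeMonoid.Sum ℤ.+-0-commutativeMonoid
  open Sum using (sum; sum-syntax)

  variable
    n : ℕ

-- Signs

sign-* : ∀ x y → sign (x * y) ≡ sign x * sign y
sign-* +0       y        = refl
sign-* +[1+ m ] +0       = cong sign (ℤ.*-zeroʳ +[1+ m ])
sign-* +[1+ m ] +[1+ _ ] = refl
sign-* +[1+ m ] -[1+ _ ] = refl
sign-* -[1+ m ] +0       = cong sign (ℤ.*-zeroʳ -[1+ m ])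
sign-* -[1+ m ] +[1+ _ ] = refl
sign-* -[1+ m ] -[1+ _ ] = refl

sign-< : ∀ {x y} → x ℤ.< y → sign (x - y) ≡ -1ℤ
sign-< {x} {y} x<y = negative (subst (x - y ℤ.<_) (ℤ.+-inverseʳ y) (ℤ.+-monoˡ-< (ℤ.- y) x<y))
  where
  negative : ∀ {z} → z ℤ.< 0ℤ → sign z ≡ -1ℤ
  negative -<+      = refl
  negative (+<+ ())

sign-> : ∀ {x y} → y ℤ.< x → sign (x - y) ≡ 1ℤ
sign-> {x} {y} y<x = positive (subst (ℤ._< x - y) (ℤ.+-inverseʳ y) (ℤ.+-monoˡ-< (ℤ.- y) y<x))
  where
  positive : ∀ {z} → 0ℤ ℤ.< z → sign z ≡ 1ℤ
  positive {+[1+ _ ]} _        = refl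
  positive {+0}       (+<+ ())

sign-≡ : ∀ {x y} → x ≡ y → sign (x - y) ≡ 0ℤ
sign-≡ {x} x≡y = cong sign (ℤ.i≡j⇒i-j≡0 x≡y)

sign-⊖-< : {i j : Fin n} → i Fin.< j → sign (i ⊖ᶠ j) ≡ -1ℤ
sign-⊖-< i<j = sign-< (+<+ i<j)

sign-⊖-> : {i j : Fin n} → j Fin.< i → sign (i ⊖ᶠ j) ≡ 1ℤ
sign-⊖-> j<i = sign-> (+<+ j<i)

sign-⊖-≡ : (i : Fin n) → sign (i ⊖ᶠ i) ≡ 0ℤ
sign-⊖-≡ i = sign-≡ {+ toℕ i} refl

sign-⊖-≢ : {i j : Fin n} → i ≢ j → IsSign (sign (i ⊖ᶠ j))
sign-⊖-≢ {i = i} {j} i≢j with Fin.<-cmp i j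
... | tri< i<j _ _ = inj₂ (sign-⊖-< i<j)
... | tri≈ _ i≡j _ = contradiction i≡j i≢j
... | tri> _ _ j<i = inj₁ (sign-⊖-> j<i)

sign-swap : ∀ x y → sign (x - y) ≡ -1ℤ * sign (y - x)
sign-swap x y with ℤ.<-cmp x y
... | tri< x<y _ _ = trans (sign-< x<y) (cong (-1ℤ *_) (sym (sign-> x<y)))
... | tri≈ _ x≡y _ = trans (sign-≡ x≡y) (cong (-1ℤ *_) (sym (sign-≡ (sym x≡y))))
... | tri> _ _ y<x = trans (sign-> y<x) (cong (-1ℤ *_) (sym (sign-< y<x)))

-- The hypothesis puts `a` and `c` strictly on opposite sides of `b`, so `a` lies on the same side
-- of `c` as of `b`. Applied to values of a solution, this is condition (3).
sign-between : ∀ a b c → sign (a - b) * sign (c - b) ≡ -1ℤ → sign (a - c) ≡ sign (a - b)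
sign-between a b c ab·cb≡-1 with ℤ.<-cmp a b | ℤ.<-cmp c b
... | tri< a<b _ _ | tri> _ _ b<c = trans (sign-< (ℤ.<-trans a<b b<c)) (sym (sign-< a<b))
... | tri> _ _ b<a | tri< c<b _ _ = trans (sign-> (ℤ.<-trans c<b b<a)) (sym (sign-> b<a))
... | tri< a<b _ _ | tri< c<b _ _ =
  contradiction (trans (sym (cong₂ _*_ (sign-< a<b) (sign-< c<b))) ab·cb≡-1) λ ()
... | tri> _ _ b<a | tri> _ _ b<c =
  contradiction (trans (sym (cong₂ _*_ (sign-> b<a) (sign-> b<c))) ab·cb≡-1) λ ()
... | tri≈ _ a≡b _ | _ =
  contradiction (trans (sym (cong (_* sign (c - b)) (sign-≡ a≡b))) ab·cb≡-1) λ ()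
... | tri< a<b _ _ | tri≈ _ c≡b _ =
  contradiction (trans (sym (cong₂ _*_ (sign-< a<b) (sign-≡ c≡b))) ab·cb≡-1) λ ()
... | tri> _ _ b<a | tri≈ _ c≡b _ =
  contradiction (trans (sym (cong₂ _*_ (sign-> b<a) (sign-≡ c≡b))) ab·cb≡-1) λ ()

IsSign-* : ∀ {x y} → IsSign x → IsSign y → IsSign (x * y)
IsSign-* (inj₁ refl) (inj₁ refl) = inj₁ refl
IsSign-* (inj₁ refl) (inj₂ refl) = inj₂ refl
IsSign-* (inj₂ refl) (inj₁ refl) = inj₂ refl
IsSign-* (inj₂ refl) (inj₂ refl) = inj₁ refl

IsSign-square : ∀ {x} → IsSign x → x * x ≡ 1ℤ
IsSign-square (inj₁ refl) = refl
IsSign-square (inj₂ refl) = refl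

IsSign-≢0 : ∀ {x} → IsSign x → x ≢ 0ℤ
IsSign-≢0 (inj₁ refl) ()
IsSign-≢0 (inj₂ refl) ()

IsSign-inverse-unique : ∀ {x y} → IsSign x → IsSign y → x * y ≡ 1ℤ → x ≡ y
IsSign-inverse-unique (inj₁ refl) (inj₁ refl) _ = refl
IsSign-inverse-unique (inj₂ refl) (inj₂ refl) _ = refl
IsSign-inverse-unique (inj₁ refl) (inj₂ refl) ()
IsSign-inverse-unique (inj₂ refl) (inj₁ refl) ()

-- Sums of indicators

𝟙 : {P : Set} → Dec P → ℤ
𝟙 P? = if does P? then 1ℤ else 0ℤ

𝟙-true : {P : Set} (P? : Dec P) → P → 𝟙 P? ≡ 1ℤ
𝟙-true P? p = cong (if_then 1ℤ else 0ℤ) (dec-true P? p)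

𝟙-false : {P : Set} (P? : Dec P) → ¬ P → 𝟙 P? ≡ 0ℤ
𝟙-false P? ¬p = cong (if_then 1ℤ else 0ℤ) (dec-false P? ¬p)

𝟙-cong : {P Q : Set} (P? : Dec P) (Q? : Dec Q) → (P → Q) → (Q → P) → 𝟙 P? ≡ 𝟙 Q?
𝟙-cong P? (yes q) _ Q→P = 𝟙-true P? (Q→P q)
𝟙-cong P? (no ¬q) P→Q _ = 𝟙-false P? (¬q ∘ P→Q)

𝟙-binary : {P : Set} (P? : Dec P) → 𝟙 P? ≡ 0ℤ ⊎ 𝟙 P? ≡ 1ℤ
𝟙-binary (yes _) = inj₂ refl
𝟙-binary (no _)  = inj₁ refl

if-cong : {P : Set} (P? : Dec P) {x y z : ℤ} → (P → x ≡ y) →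
          (if does P? then x else z) ≡ (if does P? then y else z)
if-cong (yes p) x≡y = x≡y p
if-cong (no _)  x≡y = refl

sum-zero : (f : Vector ℤ n) → (∀ i → f i ≡ 0ℤ) → sum f ≡ 0ℤ
sum-zero {n} f f≡0 = trans (Sum.sum-cong-≗ f≡0) (Sum.sum-replicate-zero n)

sum-single : (f : Vector ℤ n) (i : Fin n) → (∀ j → j ≢ i → f j ≡ 0ℤ) → sum f ≡ f i
sum-single {suc n} f zero f≡0 =
  trans (cong (_+_ (f zero)) (sum-zero _ (λ j → f≡0 (suc j) λ ()))) (ℤ.+-identityʳ _)
sum-single {suc n} f (suc i) f≡0 =
  trans (cong₂ _+_ (f≡0 zero λ ()) (sum-single (f ∘ suc) i λ j j≢i → f≡0 (suc j) (j≢i ∘ Fin.suc-injective)))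
        (ℤ.+-identityˡ _)

sum-binary : (f : Vector ℤ n) → (∀ i → f i ≡ 0ℤ ⊎ f i ≡ 1ℤ) → ∃[ m ] m ℕ.≤ n × sum f ≡ + m
sum-binary {zero}  f _ = 0 , z≤n , refl
sum-binary {suc n} f f-binary with sum-binary (f ∘ suc) (f-binary ∘ suc) | f-binary zero
... | m , m≤n , eq | inj₁ f₀≡0 = m     , ℕ.m≤n⇒m≤1+n m≤n , trans (cong₂ _+_ f₀≡0 eq) (ℤ.+-identityˡ _)
... | m , m≤n , eq | inj₂ f₀≡1 = suc m , s≤s m≤n         , cong₂ _+_ f₀≡1 eq

-- Removing the vanishing term leaves `n - 1` summands, each 0 or 1, so the total is below `n`.
sum-binary-< : (f : Vector ℤ n) → (∀ i → f i ≡ 0ℤ ⊎ f i ≡ 1ℤ) → ∀ i → f i ≡ 0ℤ →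
               ∃[ v ] sum f ≡ + toℕ {n} v
sum-binary-< {suc n} f f-binary i fᵢ≡0
  with m , m≤n , eq ← sum-binary (removeAt f i) (λ j → f-binary _) =
  fromℕ< (s≤s m≤n) , (begin
    sum f                       ≡⟨ Sum.sum-remove {i = i} f ⟩
    f i + sum (removeAt f i)    ≡⟨ cong₂ _+_ fᵢ≡0 eq ⟩
    0ℤ + + m                    ≡⟨ ℤ.+-identityˡ _ ⟩
    + m                         ≡⟨ cong +_ (Fin.toℕ-fromℕ< (s≤s m≤n)) ⟨
    + toℕ (fromℕ< (s≤s m≤n))    ∎)
  where open ≡-Reasoning

sum-< : (v : Fin n) → ∑[ u < n ] 𝟙 (u Fin.<? v) ≡ + toℕ v
sum-< {suc n} zero    = sum-zero {suc n} _ λ u → 𝟙-false (u Fin.<? zero {n}) λ ()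
sum-< {suc n} (suc v) = cong (_+_ 1ℤ) (sum-< v)

length-filter-allFin : {P : Fin n → Set} (P? : ∀ i → Dec (P i)) →
                       + length (filter P? (allFin n)) ≡ ∑[ i < n ] 𝟙 (P? i)
length-filter-allFin P? = go P? id
  where
  -- Generalized to `tabulate f`, since the tail of `allFin` is a tabulation of `suc` and not again
  -- an `allFin`.
  go : ∀ {m} {A : Set} {P : A → Set} (P? : ∀ a → Dec (P a)) (f : Fin m → A) →
       + length (filter P? (tabulate f)) ≡ ∑[ i < m ] 𝟙 (P? (f i))
  go {zero}  P? f = refl
  go {suc m} P? f with does (P? (f zero))
  ... | true  = cong (_+_ 1ℤ) (go P? (f ∘ suc))
  ... | false = trans (go P? (f ∘ suc)) (sym (ℤ.+-identityˡ _))

-- Permutations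

-- Pigeonhole principle: a missed `y` could be punched out of the codomain, leaving an injection
-- into a set with one element fewer.
injective⇒surjective : {f : Fin n → Fin n} → Injective _≡_ _≡_ f → ∀ y → ∃[ x ] f x ≡ y
injective⇒surjective {suc n} {f} f-injective y with Fin.any? (λ x → f x Fin.≟ y)
... | yes hit = hit
... | no miss = contradiction (Fin.injective⇒≤ punched-injective) ℕ.1+n≰n
  where
  missed : ∀ x → y ≢ f x
  missed x y≡fx = miss (x , sym y≡fx)

  punched-injective : Injective _≡_ _≡_ (λ x → punchOut (missed x))
  punched-injective = f-injective ∘ Fin.punchOut-injective (missed _) (missed _)

injective⇒permutation : (f : Fin n → Fin n) → Injective _≡_ _≡_ f → Permutation′ n
injective⇒permutation f f-injective =
  permutation f (proj₁ ∘ preimage) (proj₂ ∘ preimage) (λ x → f-injective (proj₂ (preimage (f x))))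
  where preimage = injective⇒surjective f-injective

⟨$⟩ʳ-injective : (π : Permutation′ n) → Injective _≡_ _≡_ (π ⟨$⟩ʳ_)
⟨$⟩ʳ-injective π eq = trans (sym (inverseˡ π)) (trans (cong (π ⟨$⟩ˡ_) eq) (inverseˡ π))

-- Rotations

-- A cyclic rotation reverses the order of a pair exactly when one of its two indices wraps around
-- and the other does not. Its effect on signs therefore splits into one factor per index, and these
-- factors form the diagonal of a conjugation of linking matrices.
record Rotation (a : Fin n) : Set where
  field
    ρ         : Permutation′ n
    flips     : Vector ℤ n
    flips-±1  : ∀ i → IsSign (flips i)
    ρ-a       : toℕ (ρ ⟨$⟩ʳ a) ≡ 0
    sign-ρ    : ∀ i j → sign ((ρ ⟨$⟩ʳ i) ⊖ᶠ (ρ ⟨$⟩ʳ j)) ≡ flips i * flips j * sign (i ⊖ᶠ j)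

-- The map is subtraction of `a` modulo `n`; the indices below `a` wrap around and carry the factor
-- -1.
rotation : (a : Fin n) → Rotation a
rotation {n} a = record
  { ρ        = injective⇒permutation r r-injective
  ; flips    = flips
  ; flips-±1 = λ i → flips-±1 i (a Fin.≤? i)
  ; ρ-a      = r-a (a Fin.≤? a)
  ; sign-ρ   = sign-r
  }
  where
  wrap< : ∀ {i : Fin n} → i Fin.< a → toℕ i ℕ.+ (n ℕ.∸ toℕ a) ℕ.< n
  wrap< {i} i<a = ℕ.<-≤-trans (ℕ.+-monoˡ-< (n ℕ.∸ toℕ a) i<a)
                              (ℕ.≤-reflexive (ℕ.m+[n∸m]≡n (ℕ.<⇒≤ (Fin.toℕ<n a))))

  -- The decision is an explicit argument, so that one case split evaluates both the shifted index
  -- and its sign.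
  shift : (i : Fin n) → Dec (a Fin.≤ i) → Fin n
  shift i (yes _)  = fromℕ< (ℕ.≤-<-trans (ℕ.m∸n≤m (toℕ i) (toℕ a)) (Fin.toℕ<n i))
  shift i (no a≰i) = fromℕ< (wrap< {i} (ℕ.≰⇒> a≰i))

  flip-sign : {i : Fin n} → Dec (a Fin.≤ i) → ℤ
  flip-sign (yes _) = 1ℤ
  flip-sign (no _)  = -1ℤ

  r : Fin n → Fin n
  r i = shift i (a Fin.≤? i)

  flips : Fin n → ℤ
  flips i = flip-sign {i} (a Fin.≤? i)

  flips-±1 : ∀ i (a≤?i : Dec (a Fin.≤ i)) → IsSign (flip-sign {i} a≤?i)
  flips-±1 i (yes _) = inj₁ refl
  flips-±1 i (no _)  = inj₂ refl

  r-a : (a≤?a : Dec (a Fin.≤ a)) → toℕ (shift a a≤?a) ≡ 0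
  r-a (yes _)  = trans (Fin.toℕ-fromℕ< _) (ℕ.n∸n≡0 (toℕ a))
  r-a (no a≰a) = contradiction ℕ.≤-refl a≰a

  monus : ∀ {x y} → y ℕ.≤ x → + (x ℕ.∸ y) ≡ + x - + y
  monus {x} {y} y≤x = trans (sym (ℤ.⊖-≥ y≤x)) (sym (ℤ.m-n≡m⊖n x y))

  shift-yes : ∀ i (a≤i : a Fin.≤ i) → + toℕ (shift i (yes a≤i)) ≡ i ⊖ᶠ a
  shift-yes i a≤i = trans (cong +_ (Fin.toℕ-fromℕ< _)) (monus a≤i)

  shift-no : ∀ i (a≰i : ¬ a Fin.≤ i) → + toℕ (shift i (no a≰i)) ≡ + toℕ i + (+ n - + toℕ a)
  shift-no i a≰i = trans (cong +_ (Fin.toℕ-fromℕ< (wrap< {i} (ℕ.≰⇒> a≰i))))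
                         (cong (_+_ (+ toℕ i)) (monus (ℕ.<⇒≤ (Fin.toℕ<n a))))

  cancel : ∀ x y c → (x + c) - (y + c) ≡ x - y
  cancel = solve-∀

  -- Unwrapped images lie below `n ∸ toℕ a`, wrapped ones do not.
  wrapped-> : ∀ i j (a≰i : ¬ a Fin.≤ i) (a≤j : a Fin.≤ j) → shift j (yes a≤j) Fin.< shift i (no a≰i)
  wrapped-> i j a≰i a≤j = subst₂ ℕ._<_ (sym (Fin.toℕ-fromℕ< _))
    (sym (Fin.toℕ-fromℕ< (wrap< {i} (ℕ.≰⇒> a≰i))))
    (ℕ.<-≤-trans (ℕ.∸-monoˡ-< (Fin.toℕ<n j) a≤j) (ℕ.m≤n+m _ (toℕ i)))

  sign-shift : ∀ i j (a≤?i : Dec (a Fin.≤ i)) (a≤?j : Dec (a Fin.≤ j)) →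
               sign (shift i a≤?i ⊖ᶠ shift j a≤?j) ≡
               flip-sign {i} a≤?i * flip-sign {j} a≤?j * sign (i ⊖ᶠ j)
  sign-shift i j (yes a≤i) (yes a≤j) = trans
    (cong sign (trans (cong₂ _-_ (shift-yes i a≤i) (shift-yes j a≤j)) (cancel (+ toℕ i) (+ toℕ j) (ℤ.- (+ toℕ a)))))
    (sym (ℤ.*-identityˡ _))
  sign-shift i j (no a≰i) (no a≰j) = trans
    (cong sign (trans (cong₂ _-_ (shift-no i a≰i) (shift-no j a≰j)) (cancel (+ toℕ i) (+ toℕ j) (+ n - + toℕ a))))
    (sym (ℤ.*-identityˡ _))
  sign-shift i j (no a≰i) (yes a≤j) = trans
    (sign-⊖-> (wrapped-> i j a≰i a≤j))
    (sym (cong (-1ℤ *_) (sign-⊖-< (ℕ.<-≤-trans (ℕ.≰⇒> a≰i) a≤j))))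
  sign-shift i j (yes a≤i) (no a≰j) = trans
    (sign-⊖-< (wrapped-> j i a≰j a≤i))
    (sym (cong (-1ℤ *_) (sign-⊖-> (ℕ.<-≤-trans (ℕ.≰⇒> a≰j) a≤i))))

  sign-r : ∀ i j → sign (r i ⊖ᶠ r j) ≡ flips i * flips j * sign (i ⊖ᶠ j)
  sign-r i j = sign-shift i j (a Fin.≤? i) (a Fin.≤? j)

  -- Equal images have difference of sign 0, whereas by `sign-r` distinct indices give a product of
  -- three nonzero signs.
  r-injective : Injective _≡_ _≡_ r
  r-injective {i} {j} ri≡rj with i Fin.≟ j
  ... | yes i≡j = i≡j
  ... | no i≢j  = contradiction
    (trans (sym (sign-r i j)) (trans (cong (λ u → sign (u ⊖ᶠ r j)) ri≡rj) (sign-⊖-≡ (r j))))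
    (IsSign-≢0 (IsSign-* (IsSign-* (flips-±1 i (a Fin.≤? i)) (flips-±1 j (a Fin.≤? j))) (sign-⊖-≢ i≢j)))

-- Matrix products

diag-⊗ : ∀ (d : Vector ℤ n) A i j → (diag d ⊗ A) i j ≡ d i * A i j
diag-⊗ {n} d A i j = trans (sum-single _ i off) (cong (_* A i j) (on (i Fin.≟ i)))
  where
  on : (i≟i : Dec (i ≡ i)) → (if does i≟i then d i else 0ℤ) ≡ d i
  on i≟i = cong (if_then d i else 0ℤ) (dec-true i≟i refl)

  off : ∀ k → k ≢ i → diag d i k * A k j ≡ 0ℤ
  off k k≢i = cong (λ b → (if b then d i else 0ℤ) * A k j) (dec-false (i Fin.≟ k) (k≢i ∘ sym))

⊗-diag : ∀ A (d : Vector ℤ n) i j → (A ⊗ diag d) i j ≡ A i j * d j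
⊗-diag A d i j = trans (sum-single _ j off)
  (cong (λ b → A i j * (if b then d j else 0ℤ)) (dec-true (j Fin.≟ j) refl))
  where
  off : ∀ k → k ≢ j → A i k * diag d k j ≡ 0ℤ
  off k k≢j = trans (cong (λ b → A i k * (if b then d k else 0ℤ)) (dec-false (k Fin.≟ j) k≢j)) (ℤ.*-zeroʳ (A i k))

⊗-permMatrix : ∀ A (π : Permutation′ n) i j → (A ⊗ permMatrix π) i j ≡ A i (π ⟨$⟩ʳ j)
⊗-permMatrix A π i j = trans (sum-single _ (π ⟨$⟩ʳ j) off)
  (trans (cong (A i (π ⟨$⟩ʳ j) *_) (𝟙-true ((π ⟨$⟩ʳ j) Fin.≟ (π ⟨$⟩ʳ j)) refl)) (ℤ.*-identityʳ (A i (π ⟨$⟩ʳ j))))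
  where
  off : ∀ k → k ≢ π ⟨$⟩ʳ j → A i k * permMatrix π k j ≡ 0ℤ
  off k k≢πj = trans (cong (A i k *_) (𝟙-false (k Fin.≟ _) k≢πj)) (ℤ.*-zeroʳ (A i k))

conjugate-entry : ∀ (d : Vector ℤ n) π X i j →
  (diag d ⊗ transpose (permMatrix π) ⊗ X ⊗ permMatrix π ⊗ diag d) i j ≡
  d i * X (π ⟨$⟩ʳ i) (π ⟨$⟩ʳ j) * d j
conjugate-entry {n} d π X i j = begin
  (DPᵗ ⊗ X ⊗ permMatrix π ⊗ diag d) i j       ≡⟨ ⊗-diag (DPᵗ ⊗ X ⊗ permMatrix π) d i j ⟩
  (DPᵗ ⊗ X ⊗ permMatrix π) i j * d j          ≡⟨ cong (_* d j) (⊗-permMatrix (DPᵗ ⊗ X) π i j) ⟩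
  (DPᵗ ⊗ X) i (π ⟨$⟩ʳ j) * d j                ≡⟨ cong (_* d j) (sum-single _ (π ⟨$⟩ʳ i) off) ⟩
  DPᵗ i (π ⟨$⟩ʳ i) * X (π ⟨$⟩ʳ i) (π ⟨$⟩ʳ j) * d j
    ≡⟨ cong (λ z → z * X (π ⟨$⟩ʳ i) (π ⟨$⟩ʳ j) * d j)
         (trans (diag-⊗ d Pᵗ i (π ⟨$⟩ʳ i)) (trans (cong (d i *_) (𝟙-true ((π ⟨$⟩ʳ i) Fin.≟ (π ⟨$⟩ʳ i)) refl)) (ℤ.*-identityʳ (d i)))) ⟩
  d i * X (π ⟨$⟩ʳ i) (π ⟨$⟩ʳ j) * d j ∎
  where
  open ≡-Reasoning

  Pᵗ DPᵗ : Matrix n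
  Pᵗ  = transpose (permMatrix π)
  DPᵗ = diag d ⊗ Pᵗ

  off : ∀ k → k ≢ π ⟨$⟩ʳ i → DPᵗ i k * X k (π ⟨$⟩ʳ j) ≡ 0ℤ
  off k k≢πi = cong (_* X k (π ⟨$⟩ʳ j))
    (trans (diag-⊗ d Pᵗ i k) (trans (cong (d i *_) (𝟙-false (k Fin.≟ _) k≢πi)) (ℤ.*-zeroʳ (d i))))

-- Row `o` reads `1 = f o * f j`, so `f` is constant and the conjugation by it is trivial. This
-- turns a switching equivalence between normalized matrices into an equality.
normalization-unique : ∀ {A B : Matrix n} {f : Vector ℤ n} (o : Fin n) → (∀ i → IsSign (f i)) →
  (∀ i j → A i j ≡ f i * B i j * f j) →
  (∀ j → j ≢ o → A o j ≡ 1ℤ) → (∀ j → j ≢ o → B o j ≡ 1ℤ) → A ≐ B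
normalization-unique {A = A} {B} {f} o f-±1 A≡fBf A-normal B-normal i j = begin
  A i j               ≡⟨ A≡fBf i j ⟩
  f i * B i j * f j   ≡⟨ cong₂ (λ x y → x * B i j * y) (constant i) (constant j) ⟩
  f o * B i j * f o   ≡⟨ regroup (f o) (B i j) ⟩
  f o * f o * B i j   ≡⟨ cong (_* B i j) (IsSign-square (f-±1 o)) ⟩
  1ℤ * B i j          ≡⟨ ℤ.*-identityˡ (B i j) ⟩
  B i j               ∎
  where
  open ≡-Reasoning

  regroup : ∀ x y → x * y * x ≡ x * x * y
  regroup = solve-∀

  constant : ∀ k → f k ≡ f o
  constant k with k Fin.≟ o
  ... | yes refl = refl
  ... | no k≢o   = sym (IsSign-inverse-unique (f-±1 o) (f-±1 k) (begin
    f o * f k           ≡⟨ cong (_* f k) (ℤ.*-identityʳ (f o)) ⟨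
    f o * 1ℤ * f k      ≡⟨ cong (λ x → f o * x * f k) (B-normal k k≢o) ⟨
    f o * B o k * f k   ≡⟨ A≡fBf o k ⟨
    A o k               ≡⟨ A-normal k k≢o ⟩
    1ℤ                  ∎))

module _ {n : ℕ} (2≤n : 2 ≤ n) (X₀ : Matrix n) (X₀-isSign : IsSignMatrix X₀) where

  open SpindleAlgorithm 2≤n X₀
  open IsSignMatrix X₀-isSign

  private
    X : Matrix n
    X = normalized

  -- The first two indices

  toℕ-first : toℕ first ≡ 0
  toℕ-first = Fin.toℕ-fromℕ< _

  toℕ-second : toℕ second ≡ 1
  toℕ-second = Fin.toℕ-fromℕ< 2≤n

  first-unique : ∀ {i : Fin n} → toℕ i ≡ 0 → i ≡ first
  first-unique i≡0 = Fin.toℕ-injective (trans i≡0 (sym toℕ-first))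

  first-< : ∀ {i} → i ≢ first → first Fin.< i
  first-< {i} i≢first = subst (ℕ._< toℕ i) (sym toℕ-first) (ℕ.n≢0⇒n>0 (i≢first ∘ first-unique))

  first-¬last : ¬ IsLast first
  first-¬last last = ℕ.<-irrefl (trans (cong suc (sym toℕ-first)) last) 2≤n

  -- The normalized matrix

  normalizer-first : normalizer first ≡ 1ℤ
  normalizer-first = cong (if_then 1ℤ else X₀ first first) (dec-true (first Fin.≟ first) refl)

  normalizer-≢ : ∀ {i} → i ≢ first → normalizer i ≡ X₀ first i
  normalizer-≢ {i} i≢first = cong (if_then 1ℤ else X₀ first i) (dec-false (i Fin.≟ first) i≢first)

  normalizer-±1 : ∀ i → IsSign (normalizer i)
  normalizer-±1 i with i Fin.≟ first
  ... | yes _      = inj₁ refl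
  ... | no i≢first = offDiagonal first i (i≢first ∘ sym)

  normalized-entry : ∀ i j → X i j ≡ normalizer i * X₀ i j * normalizer j
  normalized-entry i j =
    trans (⊗-diag (diag normalizer ⊗ X₀) normalizer i j) (cong (_* normalizer j) (diag-⊗ normalizer X₀ i j))

  normalized-symmetric : ∀ i j → X i j ≡ X j i
  normalized-symmetric i j = begin
    X i j                                ≡⟨ normalized-entry i j ⟩
    normalizer i * X₀ i j * normalizer j ≡⟨ cong (λ x → normalizer i * x * normalizer j) (symmetric i j) ⟩
    normalizer i * X₀ j i * normalizer j ≡⟨ reverse (normalizer i) (X₀ j i) (normalizer j) ⟩
    normalizer j * X₀ j i * normalizer i ≡⟨ normalized-entry j i ⟨
    X j i                                ∎
    where
    open ≡-Reasoning
    reverse : ∀ x y z → x * y * z ≡ z * y * x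
    reverse = solve-∀

  normalized-zeroDiagonal : ∀ i → X i i ≡ 0ℤ
  normalized-zeroDiagonal i = trans (normalized-entry i i)
    (trans (cong (λ x → normalizer i * x * normalizer i) (zeroDiagonal i))
           (cong (_* normalizer i) (ℤ.*-zeroʳ (normalizer i))))

  normalized-offDiagonal : ∀ i j → i ≢ j → IsSign (X i j)
  normalized-offDiagonal i j i≢j = subst IsSign (sym (normalized-entry i j))
    (IsSign-* (IsSign-* (normalizer-±1 i) (offDiagonal i j i≢j)) (normalizer-±1 j))

  normalized-first : ∀ i → i ≢ first → X first i ≡ 1ℤ
  normalized-first i i≢first = begin
    X first i                                    ≡⟨ normalized-entry first i ⟩
    normalizer first * X₀ first i * normalizer i ≡⟨ cong₂ (λ x y → x * X₀ first i * y) normalizer-first (normalizer-≢ i≢first) ⟩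
    1ℤ * X₀ first i * X₀ first i                 ≡⟨ cong (_* X₀ first i) (ℤ.*-identityˡ (X₀ first i)) ⟩
    X₀ first i * X₀ first i                      ≡⟨ IsSign-square (offDiagonal first i (i≢first ∘ sym)) ⟩
    1ℤ                                           ∎
    where open ≡-Reasoning

  -- The formula for σ

  -- The values are integers, because the algorithm computes integers that are only afterwards seen
  -- to form a permutation.
  Linked : Vector (Fin n) n → Vector ℤ n → Set
  Linked γ σ = ∀ i j → X (γ i) (γ j) ≡ sign ((i ⊖ᶠ j) * (σ i - σ j))

  linked-> : ∀ {γ} σ → Linked γ σ → ∀ {i j} → j Fin.< i → X (γ i) (γ j) ≡ sign (σ i - σ j)
  linked-> {γ} σ linked {i} {j} j<i = begin
    X (γ i) (γ j)                      ≡⟨ linked i j ⟩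
    sign ((i ⊖ᶠ j) * (σ i - σ j))      ≡⟨ sign-* (i ⊖ᶠ j) (σ i - σ j) ⟩
    sign (i ⊖ᶠ j) * sign (σ i - σ j)   ≡⟨ cong (_* sign (σ i - σ j)) (sign-⊖-> j<i) ⟩
    1ℤ * sign (σ i - σ j)              ≡⟨ ℤ.*-identityˡ _ ⟩
    sign (σ i - σ j)                   ∎
    where open ≡-Reasoning

  -- Both signs change when `i` and `j` are exchanged, so their product is symmetric like `X`, and
  -- both sides vanish on the diagonal. Condition (2) supplies exactly the entries with `j < i`.
  linked-from-> : ∀ γ σ → (∀ i j → j Fin.< i → X (γ i) (γ j) ≡ sign (σ i - σ j)) → Linked γ σ
  linked-from-> γ σ below i j with Fin.<-cmp i j
  ... | tri> _ _ j<i = trans (below i j j<i)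
    (sym (trans (sign-* (i ⊖ᶠ j) (σ i - σ j))
         (trans (cong (_* sign (σ i - σ j)) (sign-⊖-> j<i)) (ℤ.*-identityˡ _))))
  ... | tri≈ _ refl _ = trans (normalized-zeroDiagonal (γ i))
    (sym (trans (sign-* (i ⊖ᶠ i) (σ i - σ i)) (cong (_* sign (σ i - σ i)) (sign-⊖-≡ i))))
  ... | tri< i<j _ _ = begin
    X (γ i) (γ j)                      ≡⟨ normalized-symmetric (γ i) (γ j) ⟩
    X (γ j) (γ i)                      ≡⟨ below j i i<j ⟩
    sign (σ j - σ i)                   ≡⟨ sign-swap (σ j) (σ i) ⟩
    -1ℤ * sign (σ i - σ j)             ≡⟨ cong (_* sign (σ i - σ j)) (sign-⊖-< i<j) ⟨
    sign (i ⊖ᶠ j) * sign (σ i - σ j)   ≡⟨ sign-* (i ⊖ᶠ j) (σ i - σ j) ⟨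
    sign ((i ⊖ᶠ j) * (σ i - σ j))      ∎
    where open ≡-Reasoning

  inversions : Fin n → ℤ
  inversions v = ∑[ j < n ] 𝟙 (X v j ℤ.≟ -1ℤ)

  earlier : Fin n → Vector (Fin n) n → Vector ℤ n
  earlier k γ s = if does (s Fin.<? k) then X (γ s) (γ k) else 0ℤ

  σ-value-sum : ∀ k γ → σ-value k γ ≡ 1ℤ + inversions (γ k) + sum (earlier k γ)
  σ-value-sum k γ = cong (λ c → 1ℤ + c + sum (earlier k γ)) (length-filter-allFin (λ j → X (γ k) j ℤ.≟ -1ℤ))

  -- An inversion of k with an earlier j counts 1 - 1 = 0, so only the j with σ j < σ k remain.
  σ-value-rank : ∀ (τ : Permutation′ n) σ → Linked (τ ⟨$⟩ʳ_) σ →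
                 ∀ k → σ-value k (τ ⟨$⟩ʳ_) ≡ 1ℤ + ∑[ j < n ] 𝟙 (σ j ℤ.<? σ k)
  σ-value-rank τ σ linked k = begin
    σ-value k γ                                           ≡⟨ σ-value-sum k γ ⟩
    1ℤ + inversions (γ k) + sum (earlier k γ)             ≡⟨ ℤ.+-assoc 1ℤ (inversions (γ k)) _ ⟩
    1ℤ + (inversions (γ k) + sum (earlier k γ))           ≡⟨ cong (λ z → 1ℤ + (z + sum (earlier k γ)))
                                                                  (Sum.sum-permute _ τ) ⟩
    1ℤ + (sum inverted + sum (earlier k γ))               ≡⟨ cong (_+_ 1ℤ) (Sum.∑-distrib-+ inverted (earlier k γ)) ⟨
    1ℤ + ∑[ j < n ] (inverted j + earlier k γ j)          ≡⟨ cong (_+_ 1ℤ) (Sum.sum-cong-≗ pointwise) ⟩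
    1ℤ + ∑[ j < n ] 𝟙 (σ j ℤ.<? σ k)                      ∎
    where
    open ≡-Reasoning

    γ : Vector (Fin n) n
    γ = τ ⟨$⟩ʳ_

    inverted : Vector ℤ n
    inverted j = 𝟙 (X (γ k) (γ j) ℤ.≟ -1ℤ)

    -- For a concrete sign `x` and a concrete Boolean `b` the right-hand side evaluates, so each
    -- case of `pointwise` only has to supply these two.
    entries : ∀ j {x b} → X (γ k) (γ j) ≡ x → does (j Fin.<? k) ≡ b →
              inverted j + earlier k γ j ≡ 𝟙 (x ℤ.≟ -1ℤ) + (if b then x else 0ℤ)
    entries j X≡x refl = cong₂ (λ u v → 𝟙 (u ℤ.≟ -1ℤ) + (if does (j Fin.<? k) then v else 0ℤ))
                               X≡x (trans (normalized-symmetric (γ j) (γ k)) X≡x)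

    X-before : ∀ {j} → j Fin.< k → X (γ k) (γ j) ≡ sign (σ k - σ j)
    X-before = linked-> σ linked

    X-after : ∀ {j} → k Fin.< j → X (γ k) (γ j) ≡ sign (σ j - σ k)
    X-after k<j = trans (normalized-symmetric _ _) (linked-> σ linked k<j)

    pointwise : ∀ j → inverted j + earlier k γ j ≡ 𝟙 (σ j ℤ.<? σ k)
    pointwise j with Fin.<-cmp j k | ℤ.<-cmp (σ j) (σ k)
    ... | tri< j<k _ _ | tri< lt _ _ =
      trans (entries j (trans (X-before j<k) (sign-> lt)) (dec-true (j Fin.<? k) j<k)) (sym (𝟙-true (_ ℤ.<? _) lt))
    ... | tri< j<k _ _ | tri≈ ¬lt eq _ =
      trans (entries j (trans (X-before j<k) (sign-≡ (sym eq))) (dec-true (j Fin.<? k) j<k)) (sym (𝟙-false (_ ℤ.<? _) ¬lt))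
    ... | tri< j<k _ _ | tri> ¬lt _ gt =
      trans (entries j (trans (X-before j<k) (sign-< gt)) (dec-true (j Fin.<? k) j<k)) (sym (𝟙-false (_ ℤ.<? _) ¬lt))
    ... | tri≈ j≮k refl _ | _ =
      trans (entries j (normalized-zeroDiagonal _) (dec-false (j Fin.<? k) j≮k))
            (sym (𝟙-false (σ j ℤ.<? σ j) (ℤ.<-irrefl refl)))
    ... | tri> j≮k _ k<j | tri< lt _ _ =
      trans (entries j (trans (X-after k<j) (sign-< lt)) (dec-false (j Fin.<? k) j≮k)) (sym (𝟙-true (_ ℤ.<? _) lt))
    ... | tri> j≮k _ k<j | tri≈ ¬lt eq _ =
      trans (entries j (trans (X-after k<j) (sign-≡ eq)) (dec-false (j Fin.<? k) j≮k)) (sym (𝟙-false (_ ℤ.<? _) ¬lt))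
    ... | tri> j≮k _ k<j | tri> ¬lt _ gt =
      trans (entries j (trans (X-after k<j) (sign-> gt)) (dec-false (j Fin.<? k) j≮k)) (sym (𝟙-false (_ ℤ.<? _) ¬lt))

  -- The bound is a natural number, since `suc (toℕ k)` equals `n` when `k` is the last index.
  Agree : {A : Set} → ℕ → Vector A n → Vector A n → Set
  Agree m v w = ∀ s → toℕ s ℕ.< m → v s ≡ w s

  -- The inversion count reads only `γ k`, and the sum is cut off at `k`. Values already computed
  -- thus stay correct when the search overwrites later entries of `γ`.
  σ-value-cong : ∀ {k γ γ′} → Agree (suc (toℕ k)) γ γ′ → σ-value k γ ≡ σ-value k γ′
  σ-value-cong {k} {γ} {γ′} agree = begin
    σ-value k γ                                   ≡⟨ σ-value-sum k γ ⟩
    1ℤ + inversions (γ k) + sum (earlier k γ)     ≡⟨ cong₂ (λ v z → 1ℤ + inversions v + z) γk≡γ′k (Sum.sum-cong-≗ same) ⟩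
    1ℤ + inversions (γ′ k) + sum (earlier k γ′)   ≡⟨ σ-value-sum k γ′ ⟨
    σ-value k γ′                                  ∎
    where
    open ≡-Reasoning

    γk≡γ′k : γ k ≡ γ′ k
    γk≡γ′k = agree k ℕ.≤-refl

    same : ∀ s → earlier k γ s ≡ earlier k γ′ s
    same s = if-cong (s Fin.<? k) λ s<k → cong₂ X (agree s (ℕ.m<n⇒m<1+n s<k)) γk≡γ′k

  -- The first row of the normalized matrix contains no -1 and no index precedes `first`. Hence the
  -- prescribed σ(1) = 1 obeys the formula of the other positions, and the invariant can treat all
  -- positions alike.
  σ-value-first : ∀ {γ} → γ first ≡ first → σ-value first γ ≡ 1ℤ
  σ-value-first {γ} γ-first = trans (σ-value-sum first γ)
    (cong₂ (λ x y → 1ℤ + x + y)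
      (trans (cong inversions γ-first) (sum-zero _ λ j → 𝟙-false (_ ℤ.≟ _) (no-inversion j)))
      (sum-zero (earlier first γ) λ s → cong (if_then X (γ s) (γ first) else 0ℤ) (dec-false (s Fin.<? first) (≮first s))))
    where
    no-inversion : ∀ j → X first j ≢ -1ℤ
    no-inversion j X≡-1 with j Fin.≟ first
    ... | yes refl   = contradiction (trans (sym (normalized-zeroDiagonal first)) X≡-1) λ ()
    ... | no j≢first = contradiction (trans (sym (normalized-first j j≢first)) X≡-1) λ ()

    ≮first : ∀ s → ¬ s Fin.< first
    ≮first s s<first = ℕ.n≮0 (subst (toℕ s ℕ.<_) toℕ-first s<first)

  -- Solutions pass the conditions

  -- The values are those the algorithm would compute from `τ`, so a solution is given by `τ` alone:
  -- it is a complete path of the search tree.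
  record Solution (τ : Permutation′ n) : Set where
    field
      starts : τ ⟨$⟩ʳ first ≡ first
      linked : Linked (τ ⟨$⟩ʳ_) (λ i → σ-value i (τ ⟨$⟩ʳ_))

  solution-conditions : ∀ {τ k γ σ} → Solution τ → Agree (suc (toℕ k)) γ (τ ⟨$⟩ʳ_) →
                        (∀ s → s Fin.≤ k → σ s ≡ σ-value s γ) → Conditions ⟨ k , γ , σ ⟩
  solution-conditions {τ} {k} {γ} {σ} solution agree σ≡ = record
    { condition₁ = λ s s<k γk≡γs → ℕ.<-irrefl (cong toℕ (sym (⟨$⟩ʳ-injective τ
        (trans (sym (γ≡ k ℕ.≤-refl)) (trans γk≡γs (γ≡ s (ℕ.<⇒≤ s<k))))))) s<k
    ; condition₂ = entry
    ; condition₃ = betweenness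
    }
    where
    open Solution solution

    γ≡ : ∀ s → s Fin.≤ k → γ s ≡ τ ⟨$⟩ʳ s
    γ≡ s s≤k = agree s (s≤s s≤k)

    σ* : Vector ℤ n
    σ* i = σ-value i (τ ⟨$⟩ʳ_)

    σ≡σ* : ∀ s → s Fin.≤ k → σ s ≡ σ* s
    σ≡σ* s s≤k = trans (σ≡ s s≤k) (σ-value-cong λ t t≤s → agree t (ℕ.≤-trans t≤s (s≤s s≤k)))

    entry* : ∀ {s t} → s Fin.< t → X (τ ⟨$⟩ʳ t) (τ ⟨$⟩ʳ s) ≡ sign (σ* t - σ* s)
    entry* = linked-> σ* linked

    entry : ∀ s → s Fin.< k → X (γ k) (γ s) ≡ sign (σ k - σ s)
    entry s s<k rewrite γ≡ k ℕ.≤-refl | γ≡ s (ℕ.<⇒≤ s<k) | σ≡σ* k ℕ.≤-refl | σ≡σ* s (ℕ.<⇒≤ s<k) = entry* s<k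

    betweenness : ∀ j → (∀ t → t Fin.≤ k → j ≢ γ t) → ∀ s → s Fin.< k →
                 X j (γ s) * X (γ s) (γ k) ≡ -1ℤ → X j (γ k) ≡ X j (γ s)
    betweenness j fresh s s<k hyp = begin
      X j (γ k)                       ≡⟨ cong₂ X (sym (inverseʳ τ)) (γ≡ k ℕ.≤-refl) ⟩
      X (τ ⟨$⟩ʳ t) (τ ⟨$⟩ʳ k)         ≡⟨ entry* k<t ⟩
      sign (σ* t - σ* k)              ≡⟨ sign-between (σ* t) (σ* s) (σ* k) (trans (sym (cong₂ _*_ Xjs Xsk)) hyp) ⟩
      sign (σ* t - σ* s)              ≡⟨ Xjs ⟨
      X j (γ s)                       ∎
      where
      open ≡-Reasoning

      t : Fin n
      t = τ ⟨$⟩ˡ j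

      k<t : k Fin.< t
      k<t = ℕ.≰⇒> λ t≤k → fresh t t≤k (trans (sym (inverseʳ τ)) (sym (γ≡ t t≤k)))

      Xjs : X j (γ s) ≡ sign (σ* t - σ* s)
      Xjs = trans (cong₂ X (sym (inverseʳ τ)) (γ≡ s (ℕ.<⇒≤ s<k))) (entry* (ℕ.<-trans s<k k<t))

      Xsk : X (γ s) (γ k) ≡ sign (σ* k - σ* s)
      Xsk = trans (normalized-symmetric _ _)
        (trans (cong₂ X (γ≡ k ℕ.≤-refl) (γ≡ s (ℕ.<⇒≤ s<k))) (entry* s<k))

  -- All quantifiers range over `Fin n`, so the test is decidable; `visit` branches on it.
  conditions? : ∀ st → Dec (Conditions st)
  conditions? ⟨ k , γ , σ ⟩ = map′
    (λ { (c₁ , c₂ , c₃) → record { condition₁ = c₁ ; condition₂ = c₂ ; condition₃ = c₃ } })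
    (λ c → let open Conditions c in condition₁ , condition₂ , condition₃)
    (Fin.all? (λ s → s Fin.<? k →-dec ¬? (γ k Fin.≟ γ s))
     ×-dec Fin.all? (λ s → s Fin.<? k →-dec X (γ k) (γ s) ℤ.≟ sign (σ k - σ s))
     ×-dec Fin.all? (λ j →
       Fin.all? (λ t → t Fin.≤? k →-dec ¬? (j Fin.≟ γ t)) →-dec
       Fin.all? (λ s → s Fin.<? k →-dec
         X j (γ s) * X (γ s) (γ k) ℤ.≟ -1ℤ →-dec X j (γ k) ℤ.≟ X j (γ s))))

  -- The search

  -- The invariant of the search. For `m = n` it holds all that `prefix-sound` uses about a
  -- successful run.
  record Prefix (m : ℕ) (γ : Vector (Fin n) n) (σ : Vector ℤ n) : Set where
    field
      starts   : γ first ≡ first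
      values   : ∀ s → toℕ s ℕ.< m → σ s ≡ σ-value s γ
      distinct : ∀ s t → t Fin.< s → toℕ s ℕ.< m → γ s ≢ γ t
      entries  : ∀ s t → t Fin.< s → toℕ s ℕ.< m → X (γ s) (γ t) ≡ sign (σ s - σ t)

  -- The bound `0 < m` places `first` within the range of agreement, as `starts` requires.
  prefix-cong : ∀ {m γ γ′ σ σ′} → 0 ℕ.< m → Agree m γ γ′ → Agree m σ σ′ → Prefix m γ σ → Prefix m γ′ σ′
  prefix-cong {m} {γ} {γ′} {σ} {σ′} 0<m γ≡γ′ σ≡σ′ prefix = record
    { starts   = trans (sym (γ≡γ′ first (subst (ℕ._< m) (sym toℕ-first) 0<m))) starts
    ; values   = λ s s<m → trans (sym (σ≡σ′ s s<m))
        (trans (values s s<m) (σ-value-cong λ t t≤s → γ≡γ′ t (ℕ.<-≤-trans t≤s s<m)))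
    ; distinct = λ s t t<s s<m → subst₂ _≢_ (γ≡γ′ s s<m) (γ≡γ′ t (ℕ.<-trans t<s s<m)) (distinct s t t<s s<m)
    ; entries  = λ s t t<s s<m → let t<m = ℕ.<-trans t<s s<m in
        trans (sym (cong₂ X (γ≡γ′ s s<m) (γ≡γ′ t t<m)))
              (trans (entries s t t<s s<m) (cong₂ (λ x y → sign (x - y)) (σ≡σ′ s s<m) (σ≡σ′ t t<m)))
    }
    where open Prefix prefix

  prefix-suc : ∀ {k γ σ} → Prefix (toℕ k) γ σ → σ k ≡ σ-value k γ → Conditions ⟨ k , γ , σ ⟩ →
               Prefix (suc (toℕ k)) γ σ
  prefix-suc {k} {γ} {σ} prefix value conditions = record
    { starts   = starts
    ; values   = λ s s≤k → at (λ s → σ s ≡ σ-value s γ) values value s s≤k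
    ; distinct = λ s t t<s s≤k →
        at (λ s → ∀ t → t Fin.< s → γ s ≢ γ t) (λ s s<k t t<s → distinct s t t<s s<k) condition₁ s s≤k t t<s
    ; entries  = λ s t t<s s≤k →
        at (λ s → ∀ t → t Fin.< s → X (γ s) (γ t) ≡ sign (σ s - σ t))
           (λ s s<k t t<s → entries s t t<s s<k) condition₂ s s≤k t t<s
    }
    where
    open Prefix prefix
    open Conditions conditions

    at : (P : Fin n → Set) → (∀ s → s Fin.< k → P s) → P k → ∀ s → toℕ s ℕ.< suc (toℕ k) → P s
    at P before here s s≤k with ℕ.m<1+n⇒m<n∨m≡n s≤k
    ... | inj₁ s<k = before s s<k
    ... | inj₂ s≡k = subst P (sym (Fin.toℕ-injective s≡k)) here

  agree-update : ∀ {A : Set} (v : Vector A n) k a → Agree (toℕ k) v (v [ k ≔ a ])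
  agree-update v k a s s<k = sym (updateAt-minimal s k v λ s≡k → ℕ.<-irrefl (cong toℕ s≡k) s<k)

  agree-suc : ∀ {A : Set} {v w : Vector A n} k → Agree (toℕ k) v w → v k ≡ w k → Agree (suc (toℕ k)) v w
  agree-suc k agree vk≡wk s s≤k with ℕ.m<1+n⇒m<n∨m≡n s≤k
  ... | inj₁ s<k = agree s s<k
  ... | inj₂ s≡k with refl ← Fin.toℕ-injective s≡k = vk≡wk

  agree-pred : ∀ {A : Set} {v w : Vector A n} {m} → Agree (suc m) v w → Agree m v w
  agree-pred agree s s<m = agree s (ℕ.m<n⇒m<1+n s<m)

  agree-trans : ∀ {A : Set} {u v w : Vector A n} {m} → Agree m u v → Agree m v w → Agree m u w
  agree-trans u≡v v≡w s s<m = trans (u≡v s s<m) (v≡w s s<m)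

  agree-sym : ∀ {A : Set} {v w : Vector A n} {m} → Agree m v w → Agree m w v
  agree-sym v≡w s s<m = sym (v≡w s s<m)

  record Found (c : Config n) : Set where
    constructor found
    field
      {γ′}   : Vector (Fin n) n
      {σ′}   : Vector ℤ n
      run    : c ⟶* halt (spindle σ′ γ′)
      prefix : Prefix n γ′ σ′

  -- The subtree below one candidate for position `k` has been left without success. Deeper levels
  -- may have overwritten entries after `k`, hence the new vectors `γ′` and `σ′`.
  record Dismissed (c : Config n) (k : Fin n) (γ : Vector (Fin n) n) (σ : Vector ℤ n) : Set where
    constructor dismissed
    field
      {γ′}   : Vector (Fin n) n
      {σ′}   : Vector ℤ n
      run    : c ⟶* backtrack ⟨ k , γ′ , σ′ ⟩
      γ-kept : Agree (suc (toℕ k)) γ γ′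
      σ-kept : Agree (suc (toℕ k)) σ σ′
      none   : ∀ τ → Solution τ → ¬ Agree (suc (toℕ k)) γ (τ ⟨$⟩ʳ_)

  -- All candidates for position `k` above the initial `γ k` have been tried. That initial entry
  -- itself is not covered by `none`, since the main loop increments it before testing.
  record Exhausted (c : Config n) (k : Fin n) (γ : Vector (Fin n) n) (σ : Vector ℤ n) : Set where
    constructor exhausted
    field
      {γ′}   : Vector (Fin n) n
      {σ′}   : Vector ℤ n
      run    : c ⟶* backtrack ⟨ k , γ′ , σ′ ⟩
      last   : IsLast (γ′ k)
      γ-kept : Agree (toℕ k) γ γ′
      σ-kept : Agree (toℕ k) σ σ′
      none   : ∀ τ → Solution τ → Agree (toℕ k) γ (τ ⟨$⟩ʳ_) → ¬ γ k Fin.< (τ ⟨$⟩ʳ k)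

  -- The recursion is on the number d of indices after k and, for fixed k, on the
  -- number e of candidates remaining after the next one.
  visit : ∀ d {k γ σ} → suc (toℕ k) ℕ.+ d ≡ n → k ≢ first → Prefix (toℕ k) γ σ → σ k ≡ σ-value k γ →
          Found (check ⟨ k , γ , σ ⟩) ⊎ Dismissed (check ⟨ k , γ , σ ⟩) k γ σ

  explore : ∀ d e {k γ σ} → suc (toℕ k) ℕ.+ d ≡ n → suc (suc (toℕ (γ k))) ℕ.+ e ≡ n → k ≢ first →
            Prefix (toℕ k) γ σ → Found (main ⟨ k , γ , σ ⟩) ⊎ Exhausted (main ⟨ k , γ , σ ⟩) k γ σ

  visit d {k} {γ} {σ} k+d≡n k≢first prefix value with conditions? ⟨ k , γ , σ ⟩
  visit d {k} {γ} {σ} k+d≡n k≢first prefix value | no ¬conditions =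
    inj₂ (dismissed (reject ¬conditions ◅ ε) (λ _ _ → refl) (λ _ _ → refl) λ τ solution agree →
      ¬conditions (solution-conditions solution agree
        λ s s≤k → agree-suc k (Prefix.values prefix) value s (s≤s s≤k)))
  visit zero {k} {γ} {σ} k+d≡n k≢first prefix value | yes conditions =
    inj₁ (found (succeed conditions last ◅ ε) (subst (λ m → Prefix m γ σ) last (prefix-suc prefix value conditions)))
    where
    last : IsLast k
    last = trans (sym (ℕ.+-identityʳ _)) k+d≡n
  visit (suc d) {k} {γ} {σ} k+d≡n k≢first prefix value | yes conditions =
    -- The next level starts from `first` and tries index 1 of `Fin n` at once, which leaves `n ∸ 2`
    -- further candidates.
    conclude (explore d (n ℕ.∸ 2) k⁺+d≡n γ⁺+e≡n k⁺≢first prefix⁺)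
    where
    k⁺<n : suc (toℕ k) ℕ.< n
    k⁺<n = subst (suc (suc (toℕ k)) ≤_) (trans (sym (ℕ.+-suc _ d)) k+d≡n) (ℕ.m≤m+n _ d)

    k⁺ : Fin n
    k⁺ = fromℕ< k⁺<n

    k⋖k⁺ : k ⋖ k⁺
    k⋖k⁺ = Fin.toℕ-fromℕ< k⁺<n

    γ⁺ : Vector (Fin n) n
    γ⁺ = γ [ k⁺ ≔ first ]

    γ≡γ⁺ : Agree (suc (toℕ k)) γ γ⁺
    γ≡γ⁺ = subst (λ m → Agree m γ γ⁺) k⋖k⁺ (agree-update γ k⁺ first)

    γ⁺k⁺≡first : γ⁺ k⁺ ≡ first
    γ⁺k⁺≡first = updateAt-updates k⁺ γ

    k⁺+d≡n : suc (toℕ k⁺) ℕ.+ d ≡ n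
    k⁺+d≡n = trans (cong (λ m → suc m ℕ.+ d) k⋖k⁺) (trans (sym (ℕ.+-suc _ d)) k+d≡n)

    γ⁺+e≡n : suc (suc (toℕ (γ⁺ k⁺))) ℕ.+ (n ℕ.∸ 2) ≡ n
    γ⁺+e≡n = trans (cong (λ m → suc (suc m) ℕ.+ (n ℕ.∸ 2)) (trans (cong toℕ γ⁺k⁺≡first) toℕ-first))
                   (ℕ.m+[n∸m]≡n 2≤n)

    k⁺≢first : k⁺ ≢ first
    k⁺≢first k⁺≡first = ℕ.0≢1+n (trans (sym toℕ-first) (trans (cong toℕ (sym k⁺≡first)) k⋖k⁺))

    prefix⁺ : Prefix (toℕ k⁺) γ⁺ σ
    prefix⁺ = subst (λ m → Prefix m γ⁺ σ) (sym k⋖k⁺)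
      (prefix-cong (s≤s z≤n) γ≡γ⁺ (λ _ _ → refl) (prefix-suc prefix value conditions))

    -- The next level never tests the candidate `first`, but no solution takes that value at `k⁺`:
    -- it is already taken at position `first`.
    none⁺ : (∀ τ → Solution τ → Agree (toℕ k⁺) γ⁺ (τ ⟨$⟩ʳ_) → ¬ γ⁺ k⁺ Fin.< (τ ⟨$⟩ʳ k⁺)) →
            ∀ τ → Solution τ → ¬ Agree (suc (toℕ k)) γ (τ ⟨$⟩ʳ_)
    none⁺ none τ solution agree = none τ solution
      (subst (λ m → Agree m γ⁺ (τ ⟨$⟩ʳ_)) (sym k⋖k⁺) (agree-trans (agree-sym γ≡γ⁺) agree))
      (subst (Fin._< (τ ⟨$⟩ʳ k⁺)) (sym γ⁺k⁺≡first)
        (first-< λ τk⁺≡first → k⁺≢first (⟨$⟩ʳ-injective τ (trans τk⁺≡first (sym (Solution.starts solution))))))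

    conclude : Found (main ⟨ k⁺ , γ⁺ , σ ⟩) ⊎ Exhausted (main ⟨ k⁺ , γ⁺ , σ ⟩) k⁺ γ⁺ σ →
               Found (check ⟨ k , γ , σ ⟩) ⊎ Dismissed (check ⟨ k , γ , σ ⟩) k γ σ
    conclude (inj₁ (found run prefix′)) = inj₁ (found (extend conditions k⋖k⁺ ◅ run) prefix′)
    conclude (inj₂ (exhausted {γ′} {σ′} run last γ-kept σ-kept none)) = inj₂ (dismissed
      (extend conditions k⋖k⁺ ◅ run ◅◅ retreat last k⋖k⁺ ◅ ε)
      (agree-trans γ≡γ⁺ (subst (λ m → Agree m γ⁺ γ′) k⋖k⁺ γ-kept))
      (subst (λ m → Agree m σ σ′) k⋖k⁺ σ-kept)
      (none⁺ none))

  explore d e {k} {γ} {σ} k+d≡n γk+e≡n k≢first prefix =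
    conclude e γk+e≡n (visit d k+d≡n k≢first prefix′ value)
    where
    c<n : suc (toℕ (γ k)) ℕ.< n
    c<n = subst (suc (suc (toℕ (γ k))) ≤_) γk+e≡n (ℕ.m≤m+n _ e)

    c : Fin n
    c = fromℕ< c<n

    γk⋖c : γ k ⋖ c
    γk⋖c = Fin.toℕ-fromℕ< c<n

    γ₁ : Vector (Fin n) n
    γ₁ = γ [ k ≔ c ]

    σ₁ : Vector ℤ n
    σ₁ = σ [ k ≔ σ-value k γ₁ ]

    γ≡γ₁ : Agree (toℕ k) γ γ₁
    γ≡γ₁ = agree-update γ k c

    σ≡σ₁ : Agree (toℕ k) σ σ₁
    σ≡σ₁ = agree-update σ k (σ-value k γ₁)

    value : σ₁ k ≡ σ-value k γ₁
    value = updateAt-updates k σ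

    prefix′ : Prefix (toℕ k) γ₁ σ₁
    prefix′ = prefix-cong (subst (ℕ._< toℕ k) toℕ-first (first-< k≢first)) γ≡γ₁ σ≡σ₁ prefix

    start : main ⟨ k , γ , σ ⟩ ⟶ check ⟨ k , γ₁ , σ₁ ⟩
    start = advance γk⋖c

    -- A candidate above `γ k` is either its successor `c` or lies above `c`.
    none-from-c : (∀ τ → Solution τ → ¬ Agree (suc (toℕ k)) γ₁ (τ ⟨$⟩ʳ_)) →
                  (∀ τ → Solution τ → Agree (toℕ k) γ₁ (τ ⟨$⟩ʳ_) → ¬ c Fin.< (τ ⟨$⟩ʳ k)) →
                  ∀ τ → Solution τ → Agree (toℕ k) γ (τ ⟨$⟩ʳ_) → ¬ γ k Fin.< (τ ⟨$⟩ʳ k)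
    none-from-c none-at none-above τ solution agree γk<τk with ℕ.m≤n⇒m<n∨m≡n γk<τk
    ... | inj₁ c<τk = none-above τ solution (agree-trans (agree-sym γ≡γ₁) agree)
                        (subst (ℕ._< toℕ (τ ⟨$⟩ʳ k)) (sym γk⋖c) c<τk)
    ... | inj₂ c≡τk = none-at τ solution (agree-suc k (agree-trans (agree-sym γ≡γ₁) agree)
                        (trans (updateAt-updates k γ) (Fin.toℕ-injective (trans γk⋖c c≡τk))))

    -- If `e` is zero, then `c` is the last index and the level is exhausted; otherwise `resume`
    -- re-enters the main loop at the same `k`, with `c` in the role of `γ k`.
    conclude : ∀ e → suc (suc (toℕ (γ k))) ℕ.+ e ≡ n →
               Found (check ⟨ k , γ₁ , σ₁ ⟩) ⊎ Dismissed (check ⟨ k , γ₁ , σ₁ ⟩) k γ₁ σ₁ →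
               Found (main ⟨ k , γ , σ ⟩) ⊎ Exhausted (main ⟨ k , γ , σ ⟩) k γ σ
    conclude _ _ (inj₁ (found run prefix″)) = inj₁ (found (start ◅ run) prefix″)
    conclude zero γk+e≡n (inj₂ (dismissed {γ₂} {σ₂} run γ-kept σ-kept none)) = inj₂ (exhausted
      (start ◅ run)
      (subst IsLast (trans (sym (updateAt-updates k γ)) (γ-kept k ℕ.≤-refl)) c-last)
      (agree-trans γ≡γ₁ (agree-pred γ-kept))
      (agree-trans σ≡σ₁ (agree-pred σ-kept))
      (none-from-c none λ τ _ _ c<τk → ℕ.<⇒≱ (Fin.toℕ<n (τ ⟨$⟩ʳ k)) (subst (_≤ toℕ (τ ⟨$⟩ʳ k)) c-last c<τk)))
      where
      c-last : IsLast c
      c-last = trans (cong suc γk⋖c) (trans (sym (ℕ.+-identityʳ _)) γk+e≡n)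
    conclude (suc e) γk+e≡n (inj₂ (dismissed {γ₂} {σ₂} run γ-kept σ-kept none)) =
      finish (explore d e k+d≡n γ₂k+e≡n k≢first
        (prefix-cong (subst (ℕ._< toℕ k) toℕ-first (first-< k≢first)) (agree-pred γ-kept) (agree-pred σ-kept) prefix′))
      where
      c≡γ₂k : c ≡ γ₂ k
      c≡γ₂k = trans (sym (updateAt-updates k γ)) (γ-kept k ℕ.≤-refl)

      γ₂k+e≡n : suc (suc (toℕ (γ₂ k))) ℕ.+ e ≡ n
      γ₂k+e≡n = trans (cong (λ m → suc (suc m) ℕ.+ e) (trans (cong toℕ (sym c≡γ₂k)) γk⋖c))
                      (trans (sym (ℕ.+-suc _ e)) γk+e≡n)

      ¬last : ¬ IsLast (γ₂ k)
      ¬last last = ℕ.m≢1+m+n _ (trans last (sym γ₂k+e≡n))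

      start⁺ : main ⟨ k , γ , σ ⟩ ⟶* main ⟨ k , γ₂ , σ₂ ⟩
      start⁺ = start ◅ run ◅◅ resume ¬last k≢first ◅ ε

      finish : Found (main ⟨ k , γ₂ , σ₂ ⟩) ⊎ Exhausted (main ⟨ k , γ₂ , σ₂ ⟩) k γ₂ σ₂ →
               Found (main ⟨ k , γ , σ ⟩) ⊎ Exhausted (main ⟨ k , γ , σ ⟩) k γ σ
      finish (inj₁ (found run₂ prefix₂)) = inj₁ (found (start⁺ ◅◅ run₂) prefix₂)
      finish (inj₂ (exhausted run₂ last γ-kept₂ σ-kept₂ none₂)) = inj₂ (exhausted
        (start⁺ ◅◅ run₂)
        last
        (agree-trans γ≡γ₁ (agree-trans (agree-pred γ-kept) γ-kept₂))
        (agree-trans σ≡σ₁ (agree-trans (agree-pred σ-kept) σ-kept₂))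
        (none-from-c none λ τ solution agree c<τk → none₂ τ solution
          (agree-trans (agree-sym (agree-pred γ-kept)) agree)
          (subst (Fin._< (τ ⟨$⟩ʳ k)) c≡γ₂k c<τk)))

  outcome : Found initial ⊎ (StopsWith noSpindle × ∀ τ → ¬ Solution τ)
  outcome = conclude (explore (n ℕ.∸ 2) (n ℕ.∸ 2) second+d≡n first+e≡n second≢first prefix)
    where
    second+d≡n : suc (toℕ second) ℕ.+ (n ℕ.∸ 2) ≡ n
    second+d≡n = trans (cong (λ m → suc m ℕ.+ (n ℕ.∸ 2)) toℕ-second) (ℕ.m+[n∸m]≡n 2≤n)

    first+e≡n : suc (suc (toℕ first)) ℕ.+ (n ℕ.∸ 2) ≡ n
    first+e≡n = trans (cong (λ m → suc (suc m) ℕ.+ (n ℕ.∸ 2)) toℕ-first) (ℕ.m+[n∸m]≡n 2≤n)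

    first⋖second : first ⋖ second
    first⋖second = trans toℕ-second (cong suc (sym toℕ-first))

    second≢first : second ≢ first
    second≢first second≡first = ℕ.0≢1+n (trans (sym toℕ-first) (trans (cong toℕ (sym second≡first)) toℕ-second))

    below-second : ∀ {s} → s Fin.< second → s ≡ first
    below-second {s} s<second = first-unique (ℕ.n<1⇒n≡0 (subst (toℕ s ℕ.<_) toℕ-second s<second))

    none-before : ∀ {s t : Fin n} → t Fin.< s → ¬ s Fin.< second
    none-before {s} {t} t<s s<second =
      ℕ.n≮0 (subst (toℕ t ℕ.<_) (trans (cong toℕ (below-second s<second)) toℕ-first) t<s)

    -- Only position `first` lies below `second`, so the clauses about pairs are vacuous.
    prefix : Prefix (toℕ second) (const first) (const 1ℤ)
    prefix = record
      { starts   = refl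
      ; values   = λ s s<second → sym (trans (cong (λ s → σ-value s (const first)) (below-second s<second))
                                             (σ-value-first {const first} refl))
      ; distinct = λ s t t<s s<second → contradiction s<second (none-before {s} t<s)
      ; entries  = λ s t t<s s<second → contradiction s<second (none-before {s} t<s)
      }

    conclude : Found initial ⊎ Exhausted initial second (const first) (const 1ℤ) →
               Found initial ⊎ (StopsWith noSpindle × ∀ τ → ¬ Solution τ)
    conclude (inj₁ f) = inj₁ f
    conclude (inj₂ (exhausted {γ′} run last γ-kept _ none)) = inj₂
      -- Backtracking from `second` reaches `first`, where γ(1) = 1 is not the last index because
      -- `2 ≤ n`. The while loop therefore stops there and the algorithm reports failure.
      ( run ◅◅ retreat last first⋖second ◅ fail ¬last refl ◅ ε
      , λ τ solution → none τ solution
          (λ s s<second → trans (sym (Solution.starts solution)) (cong (τ ⟨$⟩ʳ_) (sym (below-second s<second))))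
          (first-< λ τ-second → second≢first (⟨$⟩ʳ-injective τ (trans τ-second (sym (Solution.starts solution))))))
      where
      ¬last : ¬ IsLast (γ′ first)
      ¬last = subst (λ v → ¬ IsLast v)
        (γ-kept first (subst₂ ℕ._<_ (sym toℕ-first) (sym toℕ-second) (s≤s z≤n))) first-¬last

  -- No step leaves a halted configuration, so determinism lets two complete runs be compared step
  -- by step. What is known about the run built in `outcome` thereby carries over to any given run.
  output-unique : ∀ {o o′} → StopsWith o → StopsWith o′ → o ≡ o′
  output-unique = unique
    where
    unique : ∀ {c o o′} → c ⟶* halt o → c ⟶* halt o′ → o ≡ o′
    unique ε            ε             = refl
    unique ε            (() ◅ _)
    unique (() ◅ _)     ε
    unique (step ◅ run) (step′ ◅ run′) with refl ← ⟶-deterministic step step′ = unique run run′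

  -- Correctness of the two outputs

  spindle-prefix : ∀ {σ γ} → StopsWith (spindle σ γ) → Prefix n γ σ
  spindle-prefix {σ} {γ} run = from outcome
    where
    from : Found initial ⊎ (StopsWith noSpindle × ∀ τ → ¬ Solution τ) → Prefix n γ σ
    from (inj₁ (found run′ prefix)) with refl ← output-unique run run′ = prefix
    from (inj₂ (run′ , _))          = contradiction (output-unique run run′) λ ()

  noSpindle-none : StopsWith noSpindle → ∀ τ → ¬ Solution τ
  noSpindle-none run = from outcome
    where
    from : Found initial ⊎ (StopsWith noSpindle × ∀ τ → ¬ Solution τ) → ∀ τ → ¬ Solution τ
    from (inj₁ (found run′ _)) = contradiction (output-unique run run′) λ ()
    from (inj₂ (_ , none))     = none

  terminates : ∃[ o ] StopsWith o
  terminates = from outcome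
    where
    from : Found initial ⊎ (StopsWith noSpindle × ∀ τ → ¬ Solution τ) → ∃[ o ] StopsWith o
    from (inj₁ (found run _)) = _ , run
    from (inj₂ (run , _))     = _ , run

  suc-cancel : ∀ x y → (1ℤ + x) - (1ℤ + y) ≡ x - y
  suc-cancel = solve-∀

  -- The permutation `π` is the rank function of `σ`, which by `σ-value-rank` is `σ` shifted down by
  -- one; `τ` is `γ` itself.
  prefix-sound : ∀ {γ σ} → Prefix n γ σ →
    ∃[ π ] ∃[ τ ]
      (∀ i → σ i ≡ + suc (toℕ (π ⟨$⟩ʳ i))) ×
      (∀ i → γ i ≡ τ ⟨$⟩ʳ i) ×
      SwitchingEquivalent X₀ (linking π) ×
      ConjugateVia τ X₀ (linking π) ×
      (∀ i → i ≢ first → X first i ≡ 1ℤ × X i first ≡ 1ℤ) ×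
      Linked γ σ
  prefix-sound {γ} {σ} prefix =
    π , τ , σ≡sucπ , (λ _ → refl) , (τ , conjugate) , conjugate ,
    (λ i i≢first → normalized-first i i≢first ,
                   trans (normalized-symmetric i first) (normalized-first i i≢first)) ,
    linked
    where
    open Prefix prefix

    γ-injective : Injective _≡_ _≡_ γ
    γ-injective {i} {j} γi≡γj with Fin.<-cmp i j
    ... | tri< i<j _ _ = contradiction (sym γi≡γj) (distinct j i i<j (Fin.toℕ<n j))
    ... | tri≈ _ i≡j _ = i≡j
    ... | tri> _ _ j<i = contradiction γi≡γj (distinct i j j<i (Fin.toℕ<n i))

    τ : Permutation′ n
    τ = injective⇒permutation γ γ-injective

    linked : Linked γ σ
    linked = linked-from-> γ σ λ i j j<i → entries i j j<i (Fin.toℕ<n i)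

    -- Two equal values would produce a zero entry of `X` off the diagonal.
    σ-injective : Injective _≡_ _≡_ σ
    σ-injective {i} {j} σi≡σj with i Fin.≟ j
    ... | yes i≡j = i≡j
    ... | no i≢j  = contradiction
      (begin
        X (γ i) (γ j)                      ≡⟨ linked i j ⟩
        sign ((i ⊖ᶠ j) * (σ i - σ j))      ≡⟨ sign-* (i ⊖ᶠ j) (σ i - σ j) ⟩
        sign (i ⊖ᶠ j) * sign (σ i - σ j)   ≡⟨ cong (sign (i ⊖ᶠ j) *_) (sign-≡ σi≡σj) ⟩
        sign (i ⊖ᶠ j) * 0ℤ                 ≡⟨ ℤ.*-zeroʳ (sign (i ⊖ᶠ j)) ⟩
        0ℤ                                 ∎)
      (IsSign-≢0 (normalized-offDiagonal _ _ (i≢j ∘ γ-injective)))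
      where open ≡-Reasoning

    -- An index is not below itself, so one of the `n` terms vanishes and the count is an element of
    -- `Fin n`.
    rank : ∀ i → ∃[ v ] ∑[ j < n ] 𝟙 (σ j ℤ.<? σ i) ≡ + toℕ {n} v
    rank i = sum-binary-< (λ j → 𝟙 (σ j ℤ.<? σ i)) (λ j → 𝟙-binary (σ j ℤ.<? σ i))
                          i (𝟙-false (σ i ℤ.<? σ i) (ℤ.<-irrefl refl))

    σ≡suc-rank : ∀ i → σ i ≡ + suc (toℕ (proj₁ (rank i)))
    σ≡suc-rank i = trans (values i (Fin.toℕ<n i))
      (trans (σ-value-rank τ σ linked i) (cong (_+_ 1ℤ) (proj₂ (rank i))))

    π : Permutation′ n
    π = injective⇒permutation (proj₁ ∘ rank) λ {i} {j} eq →
      σ-injective (trans (σ≡suc-rank i) (trans (cong (λ v → + suc (toℕ v)) eq) (sym (σ≡suc-rank j))))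

    σ≡sucπ : ∀ i → σ i ≡ + suc (toℕ (π ⟨$⟩ʳ i))
    σ≡sucπ = σ≡suc-rank

    conjugate : ConjugateVia τ X₀ (linking π)
    -- Moving the normalizing diagonal past the permutation matrix permutes its entries, which gives
    -- `normalizer ∘ γ`.
    conjugate = normalizer ∘ γ , normalizer-±1 ∘ γ , λ i j → begin
      linking π i j
        ≡⟨ cong (λ z → sign ((i ⊖ᶠ j) * z)) (suc-cancel (+ toℕ (π ⟨$⟩ʳ i)) (+ toℕ (π ⟨$⟩ʳ j))) ⟨
      sign ((i ⊖ᶠ j) * (+ suc (toℕ (π ⟨$⟩ʳ i)) - + suc (toℕ (π ⟨$⟩ʳ j))))
        ≡⟨ cong₂ (λ x y → sign ((i ⊖ᶠ j) * (x - y))) (σ≡sucπ i) (σ≡sucπ j) ⟨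
      sign ((i ⊖ᶠ j) * (σ i - σ j))
        ≡⟨ linked i j ⟨
      X (γ i) (γ j)
        ≡⟨ normalized-entry (γ i) (γ j) ⟩
      normalizer (γ i) * X₀ (γ i) (γ j) * normalizer (γ j)
        ≡⟨ conjugate-entry (normalizer ∘ γ) τ X₀ i j ⟨
      (diag (normalizer ∘ γ) ⊗ transpose (permMatrix τ) ⊗ X₀ ⊗ permMatrix τ ⊗ diag (normalizer ∘ γ)) i j ∎
      where open ≡-Reasoning

  -- From switching equivalences to solutions

  -- By `σ-value-rank` the formula computes one plus the rank of `π i` among the values of `π`. For
  -- a permutation that rank is `π i` itself, so the algorithm's formula recovers `π`.
  linking-solution : ∀ (τ π : Permutation′ n) → τ ⟨$⟩ʳ first ≡ first →
                     (∀ i j → X (τ ⟨$⟩ʳ i) (τ ⟨$⟩ʳ j) ≡ linking π i j) → Solution τ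
  linking-solution τ π starts X≡linking = record
    { starts = starts
    ; linked = λ i j → trans (linked i j) (cong₂ (λ x y → sign ((i ⊖ᶠ j) * (x - y))) (sym (value i)) (sym (value j)))
    }
    where
    σ : Vector ℤ n
    σ i = + suc (toℕ (π ⟨$⟩ʳ i))

    linked : Linked (τ ⟨$⟩ʳ_) σ
    linked i j = trans (X≡linking i j)
      (cong (λ z → sign ((i ⊖ᶠ j) * z)) (sym (suc-cancel (+ toℕ (π ⟨$⟩ʳ i)) (+ toℕ (π ⟨$⟩ʳ j)))))

    value : ∀ i → σ-value i (τ ⟨$⟩ʳ_) ≡ σ i
    value i = begin
      σ-value i (τ ⟨$⟩ʳ_)                                     ≡⟨ σ-value-rank τ σ linked i ⟩
      1ℤ + ∑[ j < n ] 𝟙 (σ j ℤ.<? σ i)                        ≡⟨ cong (_+_ 1ℤ) (Sum.sum-cong-≗ λ j →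
          𝟙-cong (σ j ℤ.<? σ i) ((π ⟨$⟩ʳ j) Fin.<? (π ⟨$⟩ʳ i)) (ℕ.s≤s⁻¹ ∘ ℤ.drop‿+<+) (+<+ ∘ s≤s)) ⟩
      1ℤ + ∑[ j < n ] 𝟙 ((π ⟨$⟩ʳ j) Fin.<? (π ⟨$⟩ʳ i))        ≡⟨ cong (_+_ 1ℤ) (Sum.sum-permute (λ v → 𝟙 (v Fin.<? (π ⟨$⟩ʳ i))) π) ⟨
      1ℤ + ∑[ v < n ] 𝟙 (v Fin.<? (π ⟨$⟩ʳ i))                 ≡⟨ cong (_+_ 1ℤ) (sum-< (π ⟨$⟩ʳ i)) ⟩
      σ i                                                     ∎
      where open ≡-Reasoning

  -- Both differences are negative, as `first` is the smallest index and the smallest value. The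
  -- linking matrix is therefore normalized, as `normalization-unique` demands.
  linking-first : ∀ (π : Permutation′ n) → π ⟨$⟩ʳ first ≡ first → ∀ j → j ≢ first → linking π first j ≡ 1ℤ
  linking-first π π-first j j≢first = trans (sign-* (first ⊖ᶠ j) _)
    (cong₂ _*_ (sign-⊖-< (first-< j≢first)) (sign-⊖-< (subst (Fin._< (π ⟨$⟩ʳ j)) (sym π-first) (first-<
      λ πj≡first → j≢first (⟨$⟩ʳ-injective π (trans πj≡first (sym π-first)))))))

  -- Rotating the indices and the values of π only changes the signs of its linking matrix by a
  -- conjugation, so both the index τ sends to first and its image under π may be taken to be first.
  switching⇒solution : ∀ π → SwitchingEquivalent X₀ (linking π) → ∃[ τ ] Solution τ
  switching⇒solution π (τ , d , d-±1 , linking≐) =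
    τ* , linking-solution τ* π* τ*-first λ p q →
      sym (normalization-unique first f-±1 linking-conjugate (linking-first π* π*-first)
             X∘τ*-normal p q)
    where
    i₀ : Fin n
    i₀ = τ ⟨$⟩ˡ first

    open Rotation (rotation i₀)
    open Rotation (rotation (π ⟨$⟩ʳ i₀)) renaming
      (ρ to ρ′; flips to flips′; flips-±1 to flips′-±1; ρ-a to ρ′-a; sign-ρ to sign-ρ′)

    index : Fin n → Fin n
    index p = ρ ⟨$⟩ˡ p

    τ* π* : Permutation′ n
    -- The composition `∘ₚ` applies its left factor first: indices are rotated back by the inverse
    -- of `ρ`, and for `π*` the values are then rotated by `ρ′`.
    τ* = flip ρ ∘ₚ τ
    π* = flip ρ ∘ₚ π ∘ₚ ρ′

    index-first : index first ≡ i₀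
    index-first = trans (cong (ρ ⟨$⟩ˡ_) (sym (first-unique ρ-a))) (inverseˡ ρ)

    τ*-first : τ* ⟨$⟩ʳ first ≡ first
    τ*-first = trans (cong (τ ⟨$⟩ʳ_) index-first) (inverseʳ τ)

    π*-first : π* ⟨$⟩ʳ first ≡ first
    π*-first = trans (cong (λ i → ρ′ ⟨$⟩ʳ (π ⟨$⟩ʳ i)) index-first) (first-unique ρ′-a)

    X∘τ*-normal : ∀ q → q ≢ first → X (τ* ⟨$⟩ʳ first) (τ* ⟨$⟩ʳ q) ≡ 1ℤ
    X∘τ*-normal q q≢first = trans (cong (λ v → X v (τ* ⟨$⟩ʳ q)) τ*-first)
      (normalized-first _ λ τq≡first → q≢first (⟨$⟩ʳ-injective τ* (trans τq≡first (sym τ*-first))))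

    N e f : Vector ℤ n
    -- The sign `e` collects the flips of both rotations and the given diagonal `d`. The factor `N`
    -- undoes the passage from `X₀` to its normalization, since it squares to 1.
    N p = normalizer (τ* ⟨$⟩ʳ p)
    e p = flips (index p) * flips′ (π ⟨$⟩ʳ index p) * d (index p)
    f p = e p * N p

    f-±1 : ∀ p → IsSign (f p)
    f-±1 p = IsSign-* (IsSign-* (IsSign-* (flips-±1 _) (flips′-±1 _)) (d-±1 _)) (normalizer-±1 _)

    linking-conjugate : ∀ p q → linking π* p q ≡ f p * X (τ* ⟨$⟩ʳ p) (τ* ⟨$⟩ʳ q) * f q
    linking-conjugate p q = begin
      linking π* p q
        ≡⟨ sign-* (p ⊖ᶠ q) _ ⟩
      sign (p ⊖ᶠ q) * sign ((π* ⟨$⟩ʳ p) ⊖ᶠ (π* ⟨$⟩ʳ q))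
        ≡⟨ cong₂ _*_ (trans (cong₂ (λ u v → sign (u ⊖ᶠ v)) (sym (inverseʳ ρ)) (sym (inverseʳ ρ))) (sign-ρ i j))
                     (sign-ρ′ (π ⟨$⟩ʳ i) (π ⟨$⟩ʳ j)) ⟩
      (a * b * sign (i ⊖ᶠ j)) * (a′ * b′ * sign ((π ⟨$⟩ʳ i) ⊖ᶠ (π ⟨$⟩ʳ j)))
        ≡⟨ collect a b (sign (i ⊖ᶠ j)) a′ b′ (sign ((π ⟨$⟩ʳ i) ⊖ᶠ (π ⟨$⟩ʳ j))) ⟩
      (a * a′) * (sign (i ⊖ᶠ j) * sign ((π ⟨$⟩ʳ i) ⊖ᶠ (π ⟨$⟩ʳ j))) * (b * b′)
        ≡⟨ cong (λ z → (a * a′) * z * (b * b′)) (sign-* (i ⊖ᶠ j) _) ⟨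
      (a * a′) * linking π i j * (b * b′)
        ≡⟨ cong (λ z → (a * a′) * z * (b * b′)) (trans (linking≐ i j) (conjugate-entry d τ X₀ i j)) ⟩
      (a * a′) * (d i * x * d j) * (b * b′)
        ≡⟨ regroup (a * a′) (d i) x (d j) (b * b′) ⟩
      e p * x * e q
        ≡⟨ insert-squares (e p) (N p) x (N q) (e q)
             (IsSign-square (normalizer-±1 (τ* ⟨$⟩ʳ p))) (IsSign-square (normalizer-±1 (τ* ⟨$⟩ʳ q))) ⟩
      f p * (N p * x * N q) * f q
        ≡⟨ cong (λ z → f p * z * f q) (normalized-entry (τ* ⟨$⟩ʳ p) (τ* ⟨$⟩ʳ q)) ⟨
      f p * X (τ* ⟨$⟩ʳ p) (τ* ⟨$⟩ʳ q) * f q ∎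
      where
      open ≡-Reasoning

      i j : Fin n
      i = index p
      j = index q

      a b a′ b′ x : ℤ
      a  = flips i
      b  = flips j
      a′ = flips′ (π ⟨$⟩ʳ i)
      b′ = flips′ (π ⟨$⟩ʳ j)
      x  = X₀ (τ* ⟨$⟩ʳ p) (τ* ⟨$⟩ʳ q)

      collect : ∀ a b s a′ b′ s′ → (a * b * s) * (a′ * b′ * s′) ≡ (a * a′) * (s * s′) * (b * b′)
      collect = solve-∀

      regroup : ∀ a d x d′ b → a * (d * x * d′) * b ≡ (a * d) * x * (b * d′)
      regroup = solve-∀

      move-squares : ∀ e m x m′ e′ → (e * m) * (m * x * m′) * (e′ * m′) ≡ (m * m) * (e * x * e′) * (m′ * m′)
      move-squares = solve-∀

      insert-squares : ∀ e m x m′ e′ → m * m ≡ 1ℤ → m′ * m′ ≡ 1ℤ →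
                       e * x * e′ ≡ (e * m) * (m * x * m′) * (e′ * m′)
      insert-squares e m x m′ e′ mm≡1 m′m′≡1 = sym (begin
        (e * m) * (m * x * m′) * (e′ * m′)     ≡⟨ move-squares e m x m′ e′ ⟩
        (m * m) * (e * x * e′) * (m′ * m′)     ≡⟨ cong₂ (λ y z → y * (e * x * e′) * z) mm≡1 m′m′≡1 ⟩
        1ℤ * (e * x * e′) * 1ℤ                 ≡⟨ ℤ.*-identityʳ _ ⟩
        1ℤ * (e * x * e′)                      ≡⟨ ℤ.*-identityˡ _ ⟩
        e * x * e′                             ∎)

mainTheorem2 : ∀ (n : ℕ) (2≤n : 2 ≤ n) (X : Matrix n) → IsSignMatrix X →
    let open SpindleAlgorithm 2≤n X in
    (∀ σ γ → StopsWith (spindle σ γ) →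
    ∃[ π ] ∃[ τ ]
    (∀ i → σ i ≡ + suc (toℕ (π ⟨$⟩ʳ i))) ×
    (∀ i → γ i ≡ τ ⟨$⟩ʳ i) ×
    SwitchingEquivalent X (linking π) ×
    ConjugateVia τ X (linking π) ×
    (∀ i → i ≢ first → normalized first i ≡ 1ℤ × normalized i first ≡ 1ℤ) ×
    (∀ i j → normalized (γ i) (γ j) ≡ sign ((i ⊖ᶠ j) * (σ i - σ j))))
    × (StopsWith noSpindle →
    ¬ (∃[ π ] SwitchingEquivalent X (linking π)))
    × (∃[ o ] StopsWith o)
mainTheorem2 n 2≤n X X-isSign =
    (λ σ γ run → prefix-sound 2≤n X X-isSign (spindle-prefix 2≤n X X-isSign run))
  , (λ { run (π , equivalent) → let τ , solution = switching⇒solution 2≤n X X-isSign π equivalent in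
         noSpindle-none 2≤n X X-isSign run τ solution })
  , terminates 2≤n X X-isSign
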